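{- Let $n,k$ be two positive integers with $k\geq 2$ and $n\geq 2(k-1)$, let $G_{n,k}$ be the graph on $n$ vertices defined in the context, and let $\boldsymbol{x}$ be the Perron vector of $G_{n,k}$, with $x_u$ its component at the vertex $u$. Then there exists an independent set $S$ in $G_{n,k}$ such that $$\sum_{u\in S} x_u^2 = \frac{1}{2} - O\Big(\frac{k^5}{n^3}\Big),$$ where the constant implied by $O(\cdot)$ is absolute (independent of $n$ and $k$).
   Context: For a connected graph $G$, the Perron vector of $G$ is the unique positive unit-length (Euclidean norm) eigenvector of the adjacency matrix $A(G)$ corresponding to its largest eigenvalue. Definition of $G_{n,k}$: write $n = (k-1)t + s$ with integers $t$ and $0\leq s<k-1$. The vertex set of $G_{n,k}$ is partitioned into $t+1$ sets $V_0,V_1,\ldots,V_t$ with $|V_0|=\cdots=|V_{t-1}|=k-1$ and $|V_t|=s$ (so $V_t$ may be empty). The edge set is $$E(G_{n,k}) = \{uv: u\in V_i,\ v\in V_{i+1},\ i=0,1,\ldots,t-1\}\cup\{uv: u,v\in V_0,\ u\neq v\}.$$ That is, $V_0$ induces a clique, each of $V_1,\ldots,V_t$ is an independent set, consecutive sets $V_i,V_{i+1}$ are completely joined, and there are no other edges. The graph $G_{n,k}$ is connected and has chromatic number $k$. -}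

module Defs where

open import Algebra.Bundles.Raw using (RawMonoid)
import Algebra.Definitions.RawMonoid as RawMonoidDefinitions
open import Data.Bool.Base using (if_then_else_)
open import Data.Fin.Base using (Fin; toℕ)
import Data.Fin.Properties as Fin
open import Data.Fin.Subset using (Subset; _∈_)
open import Data.Fin.Subset.Properties using (_∈?_)
open import Data.Nat.Base as ℕ using (ℕ; suc; NonZero; s≤s)
import Data.Nat.DivMod as ℕ
import Data.Nat.Properties as ℕ
open import Data.Product.Base using (∃-syntax; _×_; _,_)
open import Data.Rational.Base
  using (ℚ; 0ℚ; 1ℚ; ½; _+_; _*_; _-_; -_; ∣_∣; _≤_; _<_; 1/_; Positive; positive)
open import Data.Rational.Properties
open import Data.Rational.Solver using (module +-*-Solver)
open import Data.Sum.Base using (_⊎_; inj₁; inj₂; swap)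
open import Relation.Binary.Definitions using (Symmetric; Irreflexive; Decidable)
open import Relation.Binary.PropositionalEquality
  using (_≡_; refl; sym; trans; cong; cong₂; subst; module ≡-Reasoning)
open import Relation.Nullary using (¬_; does; ¬?; _×-dec_; _⊎-dec_)

-- A real is a Cauchy sequence of rationals, and _≈ᴿ_ is the usual
-- equality of such sequences.  Since the modulus is given by an ∃, the
-- ring operations can be taken termwise.

IsCauchy : (ℕ → ℚ) → Set
IsCauchy s = ∀ ε → 0ℚ < ε →
  ∃[ N ] (∀ m n → N ℕ.≤ m → N ℕ.≤ n → ∣ s m - s n ∣ < ε)

record ℝ : Set where
  constructor mkℝ
  field
    seq    : ℕ → ℚ
    cauchy : IsCauchy seq
open ℝ public

infix 4 _≈ᴿ_ _<ᴿ_ _≤ᴿ_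

_≈ᴿ_ _<ᴿ_ _≤ᴿ_ : ℝ → ℝ → Set
x ≈ᴿ y = ∀ ε → 0ℚ < ε → ∃[ N ] (∀ n → N ℕ.≤ n → ∣ seq x n - seq y n ∣ < ε)
x <ᴿ y = ∃[ ε ] 0ℚ < ε × ∃[ N ] (∀ n → N ℕ.≤ n → seq x n + ε ≤ seq y n)
x ≤ᴿ y = ∀ ε → 0ℚ < ε → ∃[ N ] (∀ n → N ℕ.≤ n → seq x n < seq y n + ε)

abstract
  halve : ∀ ε → 0ℚ < ε → ∃[ δ ] 0ℚ < δ × δ + δ ≡ ε
  halve ε 0<ε = ½ * ε , 0<½*ε , trans (sym (*-distribʳ-+ ε ½ ½)) (*-identityˡ ε)
    where
    0<½*ε : 0ℚ < ½ * ε
    0<½*ε = positive⁻¹ (½ * ε) {{pos*pos⇒pos ½ ε {{positive 0<ε}}}}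

  const-cauchy : ∀ q → IsCauchy (λ _ → q)
  const-cauchy q ε 0<ε =
    0 , λ _ _ _ _ → subst (λ d → ∣ d ∣ < ε) (sym (+-inverseʳ q)) 0<ε

  +-cauchy : ∀ {s t} → IsCauchy s → IsCauchy t → IsCauchy (λ n → s n + t n)
  +-cauchy {s} {t} cs ct ε 0<ε
    with halve ε 0<ε
  ... | δ , 0<δ , δ+δ≡ε with cs δ 0<δ | ct δ 0<δ
  ... | M , hs | N , ht = M ℕ.⊔ N , λ m n p q → begin-strict
    ∣ (s m + t m) - (s n + t n) ∣
      ≡⟨ cong ∣_∣ (solve 4 (λ a b c d → (a :+ b) :- (c :+ d) := (a :- c) :+ (b :- d))
           refl (s m) (t m) (s n) (t n)) ⟩
    ∣ (s m - s n) + (t m - t n) ∣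
      ≤⟨ ∣p+q∣≤∣p∣+∣q∣ (s m - s n) (t m - t n) ⟩
    ∣ s m - s n ∣ + ∣ t m - t n ∣
      <⟨ +-mono-< (hs m n (ℕ.m⊔n≤o⇒m≤o M N p) (ℕ.m⊔n≤o⇒m≤o M N q))
                  (ht m n (ℕ.m⊔n≤o⇒n≤o M N p) (ℕ.m⊔n≤o⇒n≤o M N q)) ⟩
    δ + δ
      ≡⟨ δ+δ≡ε ⟩
    ε ∎
    where
    open ≤-Reasoning
    open +-*-Solver

  neg-cauchy : ∀ {s} → IsCauchy s → IsCauchy (λ n → - s n)
  neg-cauchy {s} cs ε 0<ε with cs ε 0<ε
  ... | N , hs = N , λ m n p q → subst (_< ε) (eq m n) (hs m n p q)
    where
    open ≡-Reasoning
    open +-*-Solver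
    eq : ∀ m n → ∣ s m - s n ∣ ≡ ∣ (- s m) - (- s n) ∣
    eq m n = begin
      ∣ s m - s n ∣          ≡⟨ ∣-p∣≡∣p∣ (s m - s n) ⟨
      ∣ - (s m - s n) ∣      ≡⟨ cong ∣_∣ (solve 2 (λ a b → :- (a :- b) := (:- a) :- (:- b))
                                  refl (s m) (s n)) ⟩
      ∣ (- s m) - (- s n) ∣  ∎

  ∣p∣-∣q∣≤∣p-q∣ : ∀ p q → ∣ p ∣ - ∣ q ∣ ≤ ∣ p - q ∣
  ∣p∣-∣q∣≤∣p-q∣ p q = begin
    ∣ p ∣ - ∣ q ∣                ≡⟨ cong (λ r → ∣ r ∣ - ∣ q ∣)
                                     (solve 2 (λ a b → a := (a :- b) :+ b) refl p q) ⟩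
    ∣ (p - q) + q ∣ - ∣ q ∣      ≤⟨ +-monoˡ-≤ (- ∣ q ∣) (∣p+q∣≤∣p∣+∣q∣ (p - q) q) ⟩
    (∣ p - q ∣ + ∣ q ∣) - ∣ q ∣  ≡⟨ solve 2 (λ a b → (a :+ b) :- b := a) refl ∣ p - q ∣ ∣ q ∣ ⟩
    ∣ p - q ∣                    ∎
    where
    open ≤-Reasoning
    open +-*-Solver

  ∣p-q∣≡∣q-p∣ : ∀ p q → ∣ p - q ∣ ≡ ∣ q - p ∣
  ∣p-q∣≡∣q-p∣ p q = begin
    ∣ p - q ∣      ≡⟨ ∣-p∣≡∣p∣ (p - q) ⟨
    ∣ - (p - q) ∣  ≡⟨ cong ∣_∣ (solve 2 (λ a b → :- (a :- b) := b :- a) refl p q) ⟩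
    ∣ q - p ∣      ∎
    where
    open ≡-Reasoning
    open +-*-Solver

  ∣∣p∣-∣q∣∣≤∣p-q∣ : ∀ p q → ∣ ∣ p ∣ - ∣ q ∣ ∣ ≤ ∣ p - q ∣
  ∣∣p∣-∣q∣∣≤∣p-q∣ p q with ∣p∣≡p∨∣p∣≡-p (∣ p ∣ - ∣ q ∣)
  ... | inj₁ eq = ≤-trans (≤-reflexive eq) (∣p∣-∣q∣≤∣p-q∣ p q)
  ... | inj₂ eq = begin
    ∣ ∣ p ∣ - ∣ q ∣ ∣  ≡⟨ eq ⟩
    - (∣ p ∣ - ∣ q ∣)  ≡⟨ solve 2 (λ a b → :- (a :- b) := b :- a) refl ∣ p ∣ ∣ q ∣ ⟩
    ∣ q ∣ - ∣ p ∣      ≤⟨ ∣p∣-∣q∣≤∣p-q∣ q p ⟩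
    ∣ q - p ∣          ≡⟨ ∣p-q∣≡∣q-p∣ q p ⟩
    ∣ p - q ∣          ∎
    where
    open ≤-Reasoning
    open +-*-Solver

  abs-cauchy : ∀ {s} → IsCauchy s → IsCauchy (λ n → ∣ s n ∣)
  abs-cauchy {s} cs ε 0<ε with cs ε 0<ε
  ... | N , hs = N , λ m n p q → ≤-<-trans (∣∣p∣-∣q∣∣≤∣p-q∣ (s m) (s n)) (hs m n p q)

  cauchy-bounded : ∀ {s} → IsCauchy s →
    ∃[ B ] Positive B × ∃[ N ] (∀ n → N ℕ.≤ n → ∣ s n ∣ ≤ B)
  cauchy-bounded {s} cs with cs 1ℚ (positive⁻¹ 1ℚ)
  ... | N , hs = 1ℚ + ∣ s N ∣ , pos+nonNeg⇒pos 1ℚ ∣ s N ∣ {{∣-∣-nonNeg (s N)}} , N , λ n p → begin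
    ∣ s n ∣                ≡⟨ cong ∣_∣ (solve 2 (λ a b → a := (a :- b) :+ b) refl (s n) (s N)) ⟩
    ∣ (s n - s N) + s N ∣  ≤⟨ ∣p+q∣≤∣p∣+∣q∣ (s n - s N) (s N) ⟩
    ∣ s n - s N ∣ + ∣ s N ∣  ≤⟨ +-monoˡ-≤ ∣ s N ∣ (<⇒≤ (hs n N p ℕ.≤-refl)) ⟩
    1ℚ + ∣ s N ∣           ∎
    where
    open ≤-Reasoning
    open +-*-Solver

  scaled-cauchy : ∀ {s} → IsCauchy s → ∀ B → Positive B → ∀ ε → 0ℚ < ε →
    ∃[ N ] (∀ m n → N ℕ.≤ m → N ℕ.≤ n → ∣ s m - s n ∣ * B < ε)
  scaled-cauchy {s} cs B B>0 ε 0<ε =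
    let N , hs = cs (ε * B⁻¹) 0<ε/B
    in N , λ m n p q → begin-strict
      ∣ s m - s n ∣ * B  <⟨ *-monoˡ-<-pos B {{B>0}} (hs m n p q) ⟩
      (ε * B⁻¹) * B      ≡⟨ *-assoc ε B⁻¹ B ⟩
      ε * (B⁻¹ * B)      ≡⟨ cong (ε *_) (*-inverseˡ B {{pos⇒nonZero B {{B>0}}}}) ⟩
      ε * 1ℚ             ≡⟨ *-identityʳ ε ⟩
      ε                  ∎
    where
    open ≤-Reasoning
    B⁻¹ : ℚ
    B⁻¹ = (1/ B) {{pos⇒nonZero B {{B>0}}}}
    0<ε/B : 0ℚ < ε * B⁻¹
    0<ε/B = positive⁻¹ (ε * B⁻¹)
      {{pos*pos⇒pos ε {{positive 0<ε}} B⁻¹ {{1/pos⇒pos B {{B>0}}}}}}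

  *-difference : ∀ a b c d → a * b - c * d ≡ (a - c) * b + (b - d) * c
  *-difference a b c d = begin
    a * b - c * d                      ≡⟨ solve 3 (λ p q r → p :- r := (p :- q) :+ (q :- r))
                                            refl (a * b) (c * b) (c * d) ⟩
    (a * b - c * b) + (c * b - c * d)  ≡⟨ cong (λ p → (a * b + p) + (c * b - c * d))
                                            (neg-distribˡ-* c b) ⟩
    (a * b + (- c) * b) + (c * b - c * d)
                                       ≡⟨ cong₂ _+_ (sym (*-distribʳ-+ b a (- c)))
                                            (cong₂ (λ p q → p - q) (*-comm c b) (*-comm c d)) ⟩
    (a - c) * b + (b * c - d * c)      ≡⟨ cong (λ p → (a - c) * b + (b * c + p))
                                            (neg-distribˡ-* d c) ⟩
    (a - c) * b + (b * c + (- d) * c)  ≡⟨ cong ((a - c) * b +_) (sym (*-distribʳ-+ c b (- d))) ⟩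
    (a - c) * b + (b - d) * c          ∎
    where
    open ≡-Reasoning
    open +-*-Solver

  *-estimate : ∀ a b c d {A B δ} → ∣ b ∣ ≤ B → ∣ c ∣ ≤ A →
    ∣ a - c ∣ * B < δ → ∣ b - d ∣ * A < δ → ∣ a * b - c * d ∣ < δ + δ
  *-estimate a b c d {A} {B} {δ} ∣b∣≤B ∣c∣≤A ∣a-c∣B<δ ∣b-d∣A<δ = begin-strict
    ∣ a * b - c * d ∣                      ≡⟨ cong ∣_∣ (*-difference a b c d) ⟩
    ∣ (a - c) * b + (b - d) * c ∣          ≤⟨ ∣p+q∣≤∣p∣+∣q∣ ((a - c) * b) ((b - d) * c) ⟩
    ∣ (a - c) * b ∣ + ∣ (b - d) * c ∣      ≤⟨ +-mono-≤ (bound (a - c) ∣b∣≤B) (bound (b - d) ∣c∣≤A) ⟩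
    ∣ a - c ∣ * B + ∣ b - d ∣ * A          <⟨ +-mono-< ∣a-c∣B<δ ∣b-d∣A<δ ⟩
    δ + δ                                  ∎
    where
    open ≤-Reasoning
    bound : ∀ p {q r} → ∣ q ∣ ≤ r → ∣ p * q ∣ ≤ ∣ p ∣ * r
    bound p {q} {r} ∣q∣≤r = subst (_≤ ∣ p ∣ * r) (sym (∣p*q∣≡∣p∣*∣q∣ p q))
      (*-monoˡ-≤-nonNeg ∣ p ∣ {{∣-∣-nonNeg p}} ∣q∣≤r)

  *-cauchy : ∀ {s t} → IsCauchy s → IsCauchy t → IsCauchy (λ n → s n * t n)
  *-cauchy {s} {t} cs ct ε 0<ε =
    let A , A>0 , K , s≤A   = cauchy-bounded {s} cs
        B , B>0 , L , t≤B   = cauchy-bounded {t} ct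
        δ , 0<δ , δ+δ≡ε     = halve ε 0<ε
        M , hs              = scaled-cauchy {s} cs B B>0 δ 0<δ
        N , ht              = scaled-cauchy {t} ct A A>0 δ 0<δ
    in (K ℕ.⊔ L) ℕ.⊔ (M ℕ.⊔ N) , λ m n p q →
      let p₁ = ℕ.m⊔n≤o⇒m≤o (K ℕ.⊔ L) (M ℕ.⊔ N) p
          p₂ = ℕ.m⊔n≤o⇒n≤o (K ℕ.⊔ L) (M ℕ.⊔ N) p
          q₁ = ℕ.m⊔n≤o⇒m≤o (K ℕ.⊔ L) (M ℕ.⊔ N) q
          q₂ = ℕ.m⊔n≤o⇒n≤o (K ℕ.⊔ L) (M ℕ.⊔ N) q
      in <-≤-trans
           (*-estimate (s m) (t m) (s n) (t n) {A} {B} {δ}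
             (t≤B m (ℕ.m⊔n≤o⇒n≤o K L p₁))
             (s≤A n (ℕ.m⊔n≤o⇒m≤o K L q₁))
             (hs m n (ℕ.m⊔n≤o⇒m≤o M N p₂) (ℕ.m⊔n≤o⇒m≤o M N q₂))
             (ht m n (ℕ.m⊔n≤o⇒n≤o M N p₂) (ℕ.m⊔n≤o⇒n≤o M N q₂)))
           (≤-reflexive δ+δ≡ε)

infix  8 -ᴿ_
infixl 7 _*ᴿ_
infixl 6 _+ᴿ_ _-ᴿ_

fromℚ : ℚ → ℝ
fromℚ q = mkℝ (λ _ → q) (const-cauchy q)

0ᴿ 1ᴿ : ℝ
0ᴿ = fromℚ 0ℚ
1ᴿ = fromℚ 1ℚ

-ᴿ_ : ℝ → ℝ
-ᴿ x = mkℝ (λ n → - seq x n) (neg-cauchy {seq x} (cauchy x))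

_+ᴿ_ _*ᴿ_ _-ᴿ_ : ℝ → ℝ → ℝ
x +ᴿ y = mkℝ (λ n → seq x n + seq y n) (+-cauchy {seq x} {seq y} (cauchy x) (cauchy y))
x *ᴿ y = mkℝ (λ n → seq x n * seq y n) (*-cauchy {seq x} {seq y} (cauchy x) (cauchy y))
x -ᴿ y = x +ᴿ (-ᴿ y)

∣_∣ᴿ : ℝ → ℝ
∣ x ∣ᴿ = mkℝ (λ n → ∣ seq x n ∣) (abs-cauchy {seq x} (cauchy x))

+ᴿ-0ᴿ-rawMonoid : RawMonoid _ _
+ᴿ-0ᴿ-rawMonoid = record { Carrier = ℝ ; _≈_ = _≈ᴿ_ ; _∙_ = _+ᴿ_ ; ε = 0ᴿ }

open RawMonoidDefinitions +ᴿ-0ᴿ-rawMonoid public using (sum)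

infix 5 sum-over
sum-over : ∀ {n} → Subset n → (Fin n → ℝ) → ℝ
sum-over S f = sum (λ u → if does (u ∈? S) then f u else 0ᴿ)

syntax sum-over S (λ u → e) = ∑[ u ∈ S ] e

record Graph (n : ℕ) : Set₁ where
  field
    Adj    : Fin n → Fin n → Set
    symm   : Symmetric Adj
    irrefl : Irreflexive _≡_ Adj
    adj?   : Decidable Adj

Independent : ∀ {n} → Graph n → Subset n → Set
Independent G S = ∀ u v → u ∈ S → v ∈ S → ¬ Graph.Adj G u v

adjacencyMatrix : ∀ {n} → Graph n → Fin n → Fin n → ℝ
adjacencyMatrix G u v = if does (Graph.adj? G u v) then 1ᴿ else 0ᴿ

IsEigenvector : ∀ {n} → (Fin n → Fin n → ℝ) → ℝ → (Fin n → ℝ) → Set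
IsEigenvector A μ y =
  ¬ (∀ u → y u ≈ᴿ 0ᴿ) × (∀ u → sum (λ v → A u v *ᴿ y v) ≈ᴿ μ *ᴿ y u)

IsEigenvalue : ∀ {n} → (Fin n → Fin n → ℝ) → ℝ → Set
IsEigenvalue A μ = ∃[ y ] IsEigenvector A μ y

IsLargestEigenvalue : ∀ {n} → (Fin n → Fin n → ℝ) → ℝ → Set
IsLargestEigenvalue A ρ = IsEigenvalue A ρ × (∀ μ → IsEigenvalue A μ → μ ≤ᴿ ρ)

-- Unit Euclidean length is expressed through the squared norm.
record IsPerronVector {n : ℕ} (G : Graph n) (x : Fin n → ℝ) : Set where
  field
    ρ           : ℝ
    largest     : IsLargestEigenvalue (adjacencyMatrix G) ρ
    eigenvector : IsEigenvector (adjacencyMatrix G) ρ x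
    pos         : ∀ u → 0ᴿ <ᴿ x u
    unit        : sum (λ u → x u *ᴿ x u) ≈ᴿ 1ᴿ

k∸1≢0 : ∀ {k} → 2 ℕ.≤ k → NonZero (k ℕ.∸ 1)
k∸1≢0 (s≤s (s≤s _)) = _

-- The vertices 0, …, n-1 are split into consecutive runs of length k-1;
-- block u is the index i of the part V_i containing u.  With
-- n = (k-1)t + s and 0 ≤ s < k-1, the parts V_0, …, V_{t-1} have k-1
-- elements and V_t has the remaining s.
block : ∀ {n} (k : ℕ) → 2 ℕ.≤ k → Fin n → ℕ
block k 2≤k u = (toℕ u ℕ./ (k ℕ.∸ 1)) {{k∸1≢0 2≤k}}

G : (n k : ℕ) → 2 ℕ.≤ k → Graph n
G n k 2≤k = record
  { Adj    = _~_
  ; symm   = λ where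
      (inj₁ consecutive)             → inj₁ (swap consecutive)
      (inj₂ (u∈V₀ , v∈V₀ , u≢v))     → inj₂ (v∈V₀ , u∈V₀ , λ eq → u≢v (sym eq))
  ; irrefl = λ where
      refl (inj₁ (inj₁ eq))          → ℕ.1+n≢n (sym eq)
      refl (inj₁ (inj₂ eq))          → ℕ.1+n≢n (sym eq)
      refl (inj₂ (_ , _ , u≢u))      → u≢u refl
  ; adj?   = λ u v →
      (V v ℕ.≟ suc (V u) ⊎-dec V u ℕ.≟ suc (V v))
      ⊎-dec (V u ℕ.≟ 0 ×-dec V v ℕ.≟ 0 ×-dec ¬? (u Fin.≟ v))
  }
  where
  V : Fin n → ℕ
  V = block k 2≤k
  _~_ : Fin n → Fin n → Set
  u ~ v = (V v ≡ suc (V u) ⊎ V u ≡ suc (V v))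
        ⊎ (V u ≡ 0 × V v ≡ 0 × ¬ (u ≡ v))

{-# OPTIONS --safe #-}
-- Write m = k - 1 and let a₀ and s be the sums of x over V₀ and over all vertices.
-- For every vector z the eigenvalue equation gives ⟨Az, x⟩ = ρ⟨z, x⟩, so a vector
-- z ≥ 0 with Az ≥ μz shows ρ ≥ μ.  The indicator of V₀ ∪ V₁ gives ρ ≥ m, and
-- ((i + 1)(t - i))² on V_i gives ρ ≥ 2m - 18m/(t + 1)².  The parabola (t - i)² on
-- V_i has second difference 2, and at V₀ the clique leaves a surplus t²; with the
-- bound on ρ the identity then yields t²a₀ ≤ 20ms, where s² ≤ n by Cauchy-Schwarz.
-- Let S be the union of the V_i with i odd and let w be the weight of the even
-- blocks minus that of the odd ones.  Only edges inside V₀ join vertices of equal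
-- parity, so 0 ≤ ρw ≤ a₀², and therefore n³w ≤ 6400m⁵, while the weight of S is
-- 1/2 - w/2.
module Submission where

open import Algebra.Bundles using (CommutativeRing)
import Algebra.Properties.CommutativeMonoid.Sum as CommutativeMonoidSum
import Algebra.Properties.Semiring.Sum as SemiringSum
import Algebra.Solver.Ring as RingSolver
open import Algebra.Solver.Ring.AlmostCommutativeRing
  using (fromCommutativeRing; _-Raw-AlmostCommutative⟶_)
open import Data.Bool.Base using (Bool; true; false; not; if_then_else_)
open import Data.Fin.Base using (Fin; toℕ; fromℕ<; zero; suc)
import Data.Fin.Properties as Fin
open import Data.Fin.Subset using (Subset; _∈_)
open import Data.Fin.Subset.Properties using (_∈?_)
open import Data.Integer.Base as ℤ using (+_)
import Data.Integer.Properties as ℤ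
import Data.Integer.Solver as ℤ
open import Data.Maybe.Base using (Maybe; just; nothing)
open import Data.Nat.Base as ℕ using (ℕ; zero; suc; NonZero; s≤s; z≤n; _∸_)
import Data.Nat.Divisibility as ℕ
import Data.Nat.DivMod as ℕ
import Data.Nat.Properties as ℕ
import Data.Nat.Solver as ℕ
open import Data.Product.Base using (∃-syntax; _×_; _,_; proj₂; uncurry)
open import Data.Rational.Base as ℚ using (ℚ; 0ℚ; 1ℚ; ½; _/_)
import Data.Rational.Properties as ℚ
import Data.Rational.Unnormalised.Base as ℚᵘ
import Data.Rational.Unnormalised.Properties as ℚᵘ
open import Data.Sum.Base using (_⊎_; inj₁; inj₂)
open import Data.Vec.Base using (tabulate)
open import Defs hiding (sum)
open import Level using (0ℓ)
open import Relation.Binary.Bundles using (Preorder)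
open import Relation.Binary.PropositionalEquality as ≡ using (_≡_; _≢_)
import Relation.Binary.Reasoning.Preorder as PreorderReasoning
open import Relation.Binary.Structures using (IsEquivalence)
open import Relation.Nullary using (¬_; Dec; does; yes; no; contradiction)
open import Relation.Nullary.Decidable using (dec-true; from-yes)

-- The last block may be short, so every block-constant vector is chosen to vanish from index `t`
-- on. On such vectors `A` acts through full blocks, as `m` times a path whose end `V₀` carries the
-- clique. The natural test vector for a path is trigonometric; a polynomial one keeps all constants
-- rational. With `T = t + 1` and `u = (i + 1)(t - i)`, the parabola `u` itself has second
-- difference -2, a relative loss `2/u` of order `1/T` near the ends, which is too much. For `u²`
-- the two neighbouring values add up to `2u² - 12u + 2 + 2T²`, and 18 is the `c` for which
-- `T²(2T² - 12u) + cu²` is the complete square `2(3u - T²)²`. The loss of order `m/T²` in `ρ` is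
-- harmless for the second parabola: its values are at most `t²`, so the cost per vertex is a
-- multiple of `m`, like that of its second difference. Real numbers are never inverted:
-- inequalities are multiplied out, and positive factors are cancelled by means of rational lower
-- bounds.

-- Cauchy reals as an ordered commutative ring.

module Reals where
  open import Data.Rational.Base
    using (_+_; _*_; _-_; -_; ∣_∣; _≤_; _<_; 1/_; Positive; positive; nonNegative)
  open import Data.Rational.Properties
  open import Data.Rational.Solver using (module +-*-Solver)
  open import Relation.Binary.PropositionalEquality using (refl; sym; trans; cong; subst)

  pointwise : ∀ x y → (∀ n → seq x n ≡ seq y n) → x ≈ᴿ y
  pointwise x y eq ε 0<ε = 0 , λ n _ →
    subst (λ d → ∣ d ∣ < ε) (sym (trans (cong (_- seq y n) (eq n)) (+-inverseʳ (seq y n)))) 0<ε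

  ≈ᴿ-sym : ∀ x y → x ≈ᴿ y → y ≈ᴿ x
  ≈ᴿ-sym x y x≈y ε 0<ε with x≈y ε 0<ε
  ... | N , h = N , λ n N≤n → subst (_< ε) (∣p-q∣≡∣q-p∣ (seq x n) (seq y n)) (h n N≤n)

  ∣[a+c]-[b+d]∣<2δ : ∀ a b c d {δ} → ∣ a - b ∣ < δ → ∣ c - d ∣ < δ → ∣ (a + c) - (b + d) ∣ < δ + δ
  ∣[a+c]-[b+d]∣<2δ a b c d {δ} p q = begin-strict
    ∣ (a + c) - (b + d) ∣  ≡⟨ cong ∣_∣ (solve 4 (λ a b c d →
                                (a :+ c) :- (b :+ d) := (a :- b) :+ (c :- d)) refl a b c d) ⟩
    ∣ (a - b) + (c - d) ∣  ≤⟨ ∣p+q∣≤∣p∣+∣q∣ (a - b) (c - d) ⟩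
    ∣ a - b ∣ + ∣ c - d ∣  <⟨ +-mono-< p q ⟩
    δ + δ ∎
    where
    open ≤-Reasoning
    open +-*-Solver

  eventually-zip : ∀ {P Q R : ℕ → Set} → (∀ n → P n → Q n → R n) →
    ∃[ N ] (∀ n → N ℕ.≤ n → P n) → ∃[ N ] (∀ n → N ℕ.≤ n → Q n) →
    ∃[ N ] (∀ n → N ℕ.≤ n → R n)
  eventually-zip f (M , p) (N , q) = M ℕ.⊔ N , λ n r →
    f n (p n (ℕ.m⊔n≤o⇒m≤o M N r)) (q n (ℕ.m⊔n≤o⇒n≤o M N r))

  +ᴿ-cong : ∀ x x′ y y′ → x ≈ᴿ x′ → y ≈ᴿ y′ → x +ᴿ y ≈ᴿ x′ +ᴿ y′
  +ᴿ-cong x x′ y y′ x≈ y≈ ε 0<ε with halve ε 0<ε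
  ... | δ , 0<δ , refl = eventually-zip
    (λ n → ∣[a+c]-[b+d]∣<2δ (seq x n) (seq x′ n) (seq y n) (seq y′ n))
    (x≈ δ 0<δ) (y≈ δ 0<δ)

  ≈ᴿ-trans : ∀ x y z → x ≈ᴿ y → y ≈ᴿ z → x ≈ᴿ z
  ≈ᴿ-trans x y z x≈y y≈z ε 0<ε with halve ε 0<ε
  ... | δ , 0<δ , refl = eventually-zip
    (λ n p q → subst (λ d → ∣ d ∣ < δ + δ)
      (solve 3 (λ a b c → (a :+ b) :- (b :+ c) := a :- c) refl (seq x n) (seq y n) (seq z n))
      (∣[a+c]-[b+d]∣<2δ (seq x n) (seq y n) (seq y n) (seq z n) p q))
    (x≈y δ 0<δ) (y≈z δ 0<δ)
    where open +-*-Solver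

  -ᴿ-cong : ∀ x y → x ≈ᴿ y → -ᴿ x ≈ᴿ -ᴿ y
  -ᴿ-cong x y x≈y ε 0<ε with ≈ᴿ-sym x y x≈y ε 0<ε
  ... | N , h = N , λ n N≤n → subst (λ d → ∣ d ∣ < ε)
    (solve 2 (λ a b → b :- a := (:- a) :- (:- b)) refl (seq x n) (seq y n)) (h n N≤n)
    where open +-*-Solver

  unscale : ∀ {B} → Positive B → ∀ ε → 0ℚ < ε → ∃[ δ ] 0ℚ < δ × δ * B ≡ ε
  unscale {B} B>0 ε 0<ε = ε * B⁻¹
    , positive⁻¹ (ε * B⁻¹) {{pos*pos⇒pos ε {{positive 0<ε}} B⁻¹ {{1/pos⇒pos B {{B>0}}}}}}
    , trans (*-assoc ε B⁻¹ B)
        (trans (cong (ε *_) (*-inverseˡ B {{pos⇒nonZero B {{B>0}}}})) (*-identityʳ ε))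
    where
    B⁻¹ : ℚ
    B⁻¹ = (1/ B) {{pos⇒nonZero B {{B>0}}}}

  ≈ᴿ-scaled : ∀ x y → x ≈ᴿ y → ∀ {B} → Positive B → ∀ ε → 0ℚ < ε →
    ∃[ N ] (∀ n → N ℕ.≤ n → ∣ seq x n - seq y n ∣ * B < ε)
  ≈ᴿ-scaled x y x≈y {B} B>0 ε 0<ε with unscale {B} B>0 ε 0<ε
  ... | δ , 0<δ , refl with x≈y δ 0<δ
  ... | N , h = N , λ n N≤n → *-monoˡ-<-pos B {{B>0}} (h n N≤n)

  *ᴿ-cong : ∀ x x′ y y′ → x ≈ᴿ x′ → y ≈ᴿ y′ → x *ᴿ y ≈ᴿ x′ *ᴿ y′
  *ᴿ-cong x x′ y y′ x≈ y≈ ε 0<ε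
    with halve ε 0<ε | cauchy-bounded {seq x′} (cauchy x′) | cauchy-bounded {seq y} (cauchy y)
  ... | δ , 0<δ , refl | A , A>0 , K , x′≤A | B , B>0 , L , y≤B =
    eventually-zip (λ n (p , q) (r , s) →
        *-estimate (seq x n) (seq y n) (seq x′ n) (seq y′ n) {A} {B} {δ} s q p r)
      (eventually-zip (λ _ → _,_) (≈ᴿ-scaled x x′ x≈ B>0 δ 0<δ) (K , x′≤A))
      (eventually-zip (λ _ → _,_) (≈ᴿ-scaled y y′ y≈ A>0 δ 0<δ) (L , y≤B))

  ℝ-commutativeRing : CommutativeRing 0ℓ 0ℓ
  ℝ-commutativeRing = record
    { Carrier = ℝ
    ; _≈_ = _≈ᴿ_
    ; _+_ = _+ᴿ_
    ; _*_ = _*ᴿ_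
    ; -_ = -ᴿ_
    ; 0# = 0ᴿ
    ; 1# = 1ᴿ
    ; isCommutativeRing = record
      { isRing = record
        { +-isAbelianGroup = record
          { isGroup = record
            { isMonoid = record
              { isSemigroup = record
                { isMagma = record
                  { isEquivalence = isEquivalence
                  ; ∙-cong = λ {x} {y} {u} {v} → +ᴿ-cong x y u v
                  }
                ; assoc = λ x y z → pointwise ((x +ᴿ y) +ᴿ z) (x +ᴿ (y +ᴿ z))
                    λ n → +-assoc (seq x n) (seq y n) (seq z n)
                }
              ; identity = (λ x → pointwise (0ᴿ +ᴿ x) x λ n → +-identityˡ (seq x n))
                         , (λ x → pointwise (x +ᴿ 0ᴿ) x λ n → +-identityʳ (seq x n))
              }
            ; inverse = (λ x → pointwise (-ᴿ x +ᴿ x) 0ᴿ λ n → +-inverseˡ (seq x n))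
                      , (λ x → pointwise (x +ᴿ -ᴿ x) 0ᴿ λ n → +-inverseʳ (seq x n))
            ; ⁻¹-cong = λ {x} {y} → -ᴿ-cong x y
            }
          ; comm = λ x y → pointwise (x +ᴿ y) (y +ᴿ x) λ n → +-comm (seq x n) (seq y n)
          }
        ; *-cong = λ {x} {y} {u} {v} → *ᴿ-cong x y u v
        ; *-assoc = λ x y z → pointwise ((x *ᴿ y) *ᴿ z) (x *ᴿ (y *ᴿ z))
            λ n → *-assoc (seq x n) (seq y n) (seq z n)
        ; *-identity = (λ x → pointwise (1ᴿ *ᴿ x) x λ n → *-identityˡ (seq x n))
                     , (λ x → pointwise (x *ᴿ 1ᴿ) x λ n → *-identityʳ (seq x n))
        ; distrib = (λ x y z → pointwise (x *ᴿ (y +ᴿ z)) ((x *ᴿ y) +ᴿ (x *ᴿ z))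
                      λ n → *-distribˡ-+ (seq x n) (seq y n) (seq z n))
                  , (λ x y z → pointwise ((y +ᴿ z) *ᴿ x) ((y *ᴿ x) +ᴿ (z *ᴿ x))
                      λ n → *-distribʳ-+ (seq x n) (seq y n) (seq z n))
        }
      ; *-comm = λ x y → pointwise (x *ᴿ y) (y *ᴿ x) λ n → *-comm (seq x n) (seq y n)
      }
    }
    where
    isEquivalence : IsEquivalence _≈ᴿ_
    isEquivalence = record
      { refl = λ {x} → pointwise x x λ _ → refl
      ; sym = λ {x} {y} → ≈ᴿ-sym x y
      ; trans = λ {x} {y} {z} → ≈ᴿ-trans x y z
      }

  p≤∣p∣ : ∀ p → p ≤ ∣ p ∣
  p≤∣p∣ p with ≤-total 0ℚ p
  ... | inj₁ 0≤p = ≤-reflexive (sym (0≤p⇒∣p∣≡p 0≤p))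
  ... | inj₂ p≤0 = ≤-trans p≤0 (0≤∣p∣ p)

  ≤ᴿ-reflexive : ∀ x y → x ≈ᴿ y → x ≤ᴿ y
  ≤ᴿ-reflexive x y x≈y ε 0<ε with x≈y ε 0<ε
  ... | N , h = N , λ n N≤n → begin-strict
      seq x n                        ≡⟨ solve 2 (λ a b → a := b :+ (a :- b)) refl (seq x n) (seq y n) ⟩
      seq y n + (seq x n - seq y n)  ≤⟨ +-monoʳ-≤ (seq y n) (p≤∣p∣ (seq x n - seq y n)) ⟩
      seq y n + ∣ seq x n - seq y n ∣ <⟨ +-monoʳ-< (seq y n) (h n N≤n) ⟩
      seq y n + ε ∎
    where
    open ≤-Reasoning
    open +-*-Solver

  ≤ᴿ-trans : ∀ x y z → x ≤ᴿ y → y ≤ᴿ z → x ≤ᴿ z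
  ≤ᴿ-trans x y z x≤y y≤z ε 0<ε with halve ε 0<ε
  ... | δ , 0<δ , refl = eventually-zip
    (λ n p q → <-≤-trans (<-trans p (+-monoˡ-< δ q)) (≤-reflexive (+-assoc (seq z n) δ δ)))
    (x≤y δ 0<δ) (y≤z δ 0<δ)

  +ᴿ-mono-≤ᴿ : ∀ x y u v → x ≤ᴿ y → u ≤ᴿ v → x +ᴿ u ≤ᴿ y +ᴿ v
  +ᴿ-mono-≤ᴿ x y u v x≤y u≤v ε 0<ε with halve ε 0<ε
  ... | δ , 0<δ , refl = eventually-zip
    (λ n p q → <-≤-trans (+-mono-< p q) (≤-reflexive
      (solve 3 (λ a b d → (a :+ d) :+ (b :+ d) := (a :+ b) :+ (d :+ d)) refl (seq y n) (seq v n) δ)))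
    (x≤y δ 0<δ) (u≤v δ 0<δ)
    where open +-*-Solver

  p<p+ε : ∀ p {ε} → 0ℚ < ε → p < p + ε
  p<p+ε p {ε} 0<ε = subst (_< p + ε) (+-identityʳ p) (+-monoʳ-< p 0<ε)

  eventually-≤⇒≤ᴿ : ∀ x y → ∃[ N ] (∀ n → N ℕ.≤ n → seq x n ≤ seq y n) → x ≤ᴿ y
  eventually-≤⇒≤ᴿ x y (N , h) ε 0<ε = N , λ n N≤n → ≤-<-trans (h n N≤n) (p<p+ε (seq y n) 0<ε)

  -- Eventually the negative terms of `x` exceed `- δ`, so an absolute value moves a term by less
  -- than `δ + δ`. This reduces products of nonnegative reals to products of absolute values, which
  -- are nonnegative term by term.
  0≤⇒≈∣∣ : ∀ x → 0ᴿ ≤ᴿ x → x ≈ᴿ ∣ x ∣ᴿ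
  0≤⇒≈∣∣ x 0≤x ε 0<ε with halve ε 0<ε
  ... | δ , 0<δ , refl with 0≤x δ 0<δ
  ... | N , h = N , λ n N≤n → bound (seq x n) (h n N≤n)
    where
    open ≤-Reasoning
    open +-*-Solver
    bound : ∀ p → 0ℚ < p + δ → ∣ p - ∣ p ∣ ∣ < δ + δ
    bound p 0<p+δ with ∣p∣≡p∨∣p∣≡-p p
    ... | inj₁ eq = subst (λ q → ∣ p - q ∣ < δ + δ) (sym eq)
      (subst (λ q → ∣ q ∣ < δ + δ) (sym (+-inverseʳ p)) 0<ε)
    ... | inj₂ eq = begin-strict
      ∣ p - ∣ p ∣ ∣    ≡⟨ cong (λ q → ∣ p - q ∣) eq ⟩
      ∣ p - (- p) ∣    ≡⟨ cong ∣_∣ (solve 1 (λ p → p :- (:- p) := p :+ p) refl p) ⟩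
      ∣ p + p ∣        ≤⟨ ∣p+q∣≤∣p∣+∣q∣ p p ⟩
      ∣ p ∣ + ∣ p ∣    <⟨ +-mono-< ∣p∣<δ ∣p∣<δ ⟩
      δ + δ            ∎
      where
      ∣p∣<δ : ∣ p ∣ < δ
      ∣p∣<δ = begin-strict
        ∣ p ∣            ≡⟨ eq ⟩
        - p              <⟨ p<p+ε (- p) 0<p+δ ⟩
        - p + (p + δ)    ≡⟨ solve 2 (λ p δ → :- p :+ (p :+ δ) := δ) refl p δ ⟩
        δ                ∎

  0≤x*ᴿy : ∀ x y → 0ᴿ ≤ᴿ x → 0ᴿ ≤ᴿ y → 0ᴿ ≤ᴿ x *ᴿ y
  0≤x*ᴿy x y 0≤x 0≤y = ≤ᴿ-trans 0ᴿ (∣ x ∣ᴿ *ᴿ ∣ y ∣ᴿ) (x *ᴿ y)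
    (eventually-≤⇒≤ᴿ 0ᴿ (∣ x ∣ᴿ *ᴿ ∣ y ∣ᴿ) (0 , λ n _ →
      ≤-trans (0≤∣p∣ (seq x n * seq y n)) (≤-reflexive (∣p*q∣≡∣p∣*∣q∣ (seq x n) (seq y n)))))
    (≤ᴿ-reflexive (∣ x ∣ᴿ *ᴿ ∣ y ∣ᴿ) (x *ᴿ y)
      (≈ᴿ-sym (x *ᴿ y) (∣ x ∣ᴿ *ᴿ ∣ y ∣ᴿ)
        (*ᴿ-cong x ∣ x ∣ᴿ y ∣ y ∣ᴿ (0≤⇒≈∣∣ x 0≤x) (0≤⇒≈∣∣ y 0≤y))))

  -- If yₙ ≤ -ε while xₙ > q/2 then xₙyₙ ≤ -qε/2.
  0≤y-from-x*ᴿy : ∀ q x y → 0ℚ < q → fromℚ q ≤ᴿ x → 0ᴿ ≤ᴿ x *ᴿ y → 0ᴿ ≤ᴿ y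
  0≤y-from-x*ᴿy q x y 0<q q≤x 0≤xy ε 0<ε with halve q 0<q
  ... | δ , 0<δ , refl = eventually-zip
    (λ n → bound (seq x n) (seq y n)) (q≤x δ 0<δ) (0≤xy (ε * δ) 0<εδ)
    where
    open ≤-Reasoning
    open +-*-Solver
    0<εδ : 0ℚ < ε * δ
    0<εδ = positive⁻¹ (ε * δ) {{pos*pos⇒pos ε {{positive 0<ε}} δ {{positive 0<δ}}}}
    bound : ∀ a b → δ + δ < a + δ → 0ℚ < a * b + ε * δ → 0ℚ < b + ε
    bound a b 2δ<a+δ 0<ab+εδ with 0ℚ <? b + ε
    ... | yes 0<b+ε = 0<b+ε
    ... | no 0≮b+ε = contradiction (<-≤-trans 0<ab+εδ (begin
      a * b + ε * δ                        ≡⟨ solve 4 (λ a b ε δ → a :* b :+ ε :* δ :=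
                                                a :* (b :+ ε) :+ :- ((a :- δ) :* ε)) refl a b ε δ ⟩
      a * (b + ε) + (- ((a - δ) * ε))      ≤⟨ +-mono-≤
                                                (*-monoˡ-≤-nonNeg a {{nonNegative (≤-trans (<⇒≤ 0<δ) δ≤a)}} (≮⇒≥ 0≮b+ε))
                                                (neg-antimono-≤ 0≤[a-δ]ε) ⟩
      a * 0ℚ + (- 0ℚ)                      ≡⟨ solve 1 (λ a → a :* con 0ℚ :+ :- con 0ℚ := con 0ℚ) refl a ⟩
      0ℚ                                   ∎)) (<-irrefl refl)
      where
      0≤a-δ : 0ℚ ≤ a - δ
      0≤a-δ = begin
        0ℚ                          ≡⟨ solve 1 (λ δ → con 0ℚ := (δ :+ δ) :- (δ :+ δ)) refl δ ⟩
        (δ + δ) - (δ + δ)           ≤⟨ +-monoˡ-≤ (- (δ + δ)) (<⇒≤ 2δ<a+δ) ⟩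
        (a + δ) - (δ + δ)           ≡⟨ solve 2 (λ a δ → (a :+ δ) :- (δ :+ δ) := a :- δ) refl a δ ⟩
        a - δ                       ∎
      δ≤a : δ ≤ a
      δ≤a = begin
        δ              ≡⟨ +-identityˡ δ ⟨
        0ℚ + δ         ≤⟨ +-monoˡ-≤ δ 0≤a-δ ⟩
        (a - δ) + δ    ≡⟨ solve 2 (λ a δ → (a :- δ) :+ δ := a) refl a δ ⟩
        a              ∎
      0≤[a-δ]ε : 0ℚ ≤ (a - δ) * ε
      0≤[a-δ]ε = begin
        0ℚ               ≡⟨ *-zeroˡ ε ⟨
        0ℚ * ε           ≤⟨ *-monoʳ-≤-nonNeg ε {{nonNegative (<⇒≤ 0<ε)}} 0≤a-δ ⟩
        (a - δ) * ε      ∎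

  -- The sign of a real is undecidable, but that of each term is decidable, and one of the two
  -- bounds applies to it.
  ∣x∣≤ᴿ : ∀ x y → x ≤ᴿ y → -ᴿ x ≤ᴿ y → ∣ x ∣ᴿ ≤ᴿ y
  ∣x∣≤ᴿ x y x≤y -x≤y ε 0<ε = eventually-zip bound (x≤y ε 0<ε) (-x≤y ε 0<ε)
    where
    bound : ∀ n → seq x n < seq y n + ε → - seq x n < seq y n + ε → ∣ seq x n ∣ < seq y n + ε
    bound n p q with ∣p∣≡p∨∣p∣≡-p (seq x n)
    ... | inj₁ eq = subst (_< seq y n + ε) (sym eq) p
    ... | inj₂ eq = subst (_< seq y n + ε) (sym eq) q

  p*p≥0 : ∀ p → 0ℚ ≤ p * p
  p*p≥0 p = begin
    0ℚ             ≤⟨ 0≤∣p∣ (p * p) ⟩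
    ∣ p * p ∣      ≡⟨ ∣p*q∣≡∣p∣*∣q∣ p p ⟩
    ∣ p ∣ * ∣ p ∣  ≡⟨ ∣p∣²≡p² (∣p∣≡p∨∣p∣≡-p p) ⟩
    p * p          ∎
    where
    open ≤-Reasoning
    open +-*-Solver
    ∣p∣²≡p² : ∣ p ∣ ≡ p ⊎ ∣ p ∣ ≡ - p → ∣ p ∣ * ∣ p ∣ ≡ p * p
    ∣p∣²≡p² (inj₁ eq) = ≡.cong₂ _*_ eq eq
    ∣p∣²≡p² (inj₂ eq) = trans (≡.cong₂ _*_ eq eq) (solve 1 (λ p → :- p :* :- p := p :* p) refl p)

-- Natural numbers and their quotients inside the rationals.

-- `_/_` divides by a gcd, which does not reduce on variables; the identity is therefore checked on
-- unnormalised fractions.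
/1-homo-+ : ∀ a b → + (a ℕ.+ b) / 1 ≡ (+ a / 1) ℚ.+ (+ b / 1)
/1-homo-+ a b = ℚ.toℚᵘ-injective (begin
  ℚ.toℚᵘ (+ (a ℕ.+ b) / 1)                       ≈⟨ ℚ.toℚᵘ-fromℚᵘ (ℚᵘ.mkℚᵘ (+ (a ℕ.+ b)) 0) ⟩
  ℚᵘ.mkℚᵘ (+ (a ℕ.+ b)) 0                        ≈⟨ ℚᵘ.*≡* (solve 2 (λ a b →
      (a :+ b) :* con (+ 1) := (a :* con (+ 1) :+ b :* con (+ 1)) :* con (+ 1)) ≡.refl (+ a) (+ b)) ⟩
  ℚᵘ.mkℚᵘ (+ a) 0 ℚᵘ.+ ℚᵘ.mkℚᵘ (+ b) 0           ≈⟨ ℚᵘ.+-cong (ℚ.toℚᵘ-fromℚᵘ (ℚᵘ.mkℚᵘ (+ a) 0))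
                                                              (ℚ.toℚᵘ-fromℚᵘ (ℚᵘ.mkℚᵘ (+ b) 0)) ⟨
  ℚ.toℚᵘ (+ a / 1) ℚᵘ.+ ℚ.toℚᵘ (+ b / 1)         ≈⟨ ℚ.toℚᵘ-homo-+ (+ a / 1) (+ b / 1) ⟨
  ℚ.toℚᵘ ((+ a / 1) ℚ.+ (+ b / 1))               ∎)
  where
  open import Relation.Binary.Reasoning.Setoid ℚᵘ.≃-setoid
  open ℤ.+-*-Solver

/1-homo-* : ∀ a b → + (a ℕ.* b) / 1 ≡ (+ a / 1) ℚ.* (+ b / 1)
/1-homo-* a b = ℚ.toℚᵘ-injective (begin
  ℚ.toℚᵘ (+ (a ℕ.* b) / 1)                       ≈⟨ ℚ.toℚᵘ-fromℚᵘ (ℚᵘ.mkℚᵘ (+ (a ℕ.* b)) 0) ⟩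
  ℚᵘ.mkℚᵘ (+ (a ℕ.* b)) 0                        ≈⟨ ℚᵘ.*≡* (≡.cong (ℤ._* + 1) (ℤ.pos-* a b)) ⟩
  ℚᵘ.mkℚᵘ (+ a) 0 ℚᵘ.* ℚᵘ.mkℚᵘ (+ b) 0           ≈⟨ ℚᵘ.*-cong (ℚ.toℚᵘ-fromℚᵘ (ℚᵘ.mkℚᵘ (+ a) 0))
                                                              (ℚ.toℚᵘ-fromℚᵘ (ℚᵘ.mkℚᵘ (+ b) 0)) ⟨
  ℚ.toℚᵘ (+ a / 1) ℚᵘ.* ℚ.toℚᵘ (+ b / 1)         ≈⟨ ℚ.toℚᵘ-homo-* (+ a / 1) (+ b / 1) ⟨
  ℚ.toℚᵘ ((+ a / 1) ℚ.* (+ b / 1))               ∎)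
  where open import Relation.Binary.Reasoning.Setoid ℚᵘ.≃-setoid

[a/b]*b≡a : ∀ a b .{{_ : NonZero b}} → (+ a / b) ℚ.* (+ b / 1) ≡ + a / 1
[a/b]*b≡a a b@(suc b-1) = ℚ.toℚᵘ-injective (begin
  ℚ.toℚᵘ ((+ a / b) ℚ.* (+ b / 1))               ≈⟨ ℚ.toℚᵘ-homo-* (+ a / b) (+ b / 1) ⟩
  ℚ.toℚᵘ (+ a / b) ℚᵘ.* ℚ.toℚᵘ (+ b / 1)         ≈⟨ ℚᵘ.*-cong (ℚ.toℚᵘ-fromℚᵘ (ℚᵘ.mkℚᵘ (+ a) b-1))
                                                              (ℚ.toℚᵘ-fromℚᵘ (ℚᵘ.mkℚᵘ (+ b) 0)) ⟩
  ℚᵘ.mkℚᵘ (+ a) b-1 ℚᵘ.* ℚᵘ.mkℚᵘ (+ b) 0         ≈⟨ ℚᵘ.*≡* (≡.trans (ℤ.*-identityʳ (+ a ℤ.* + b))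
                                                       (≡.cong (λ d → + a ℤ.* + d) (≡.sym (ℕ.*-identityʳ b)))) ⟩
  ℚᵘ.mkℚᵘ (+ a) 0                                ≈⟨ ℚ.toℚᵘ-fromℚᵘ (ℚᵘ.mkℚᵘ (+ a) 0) ⟨
  ℚ.toℚᵘ (+ a / 1)                               ∎)
  where open import Relation.Binary.Reasoning.Setoid ℚᵘ.≃-setoid

-- Ordered algebras over the rationals: inequalities, numerals, finite sums.

-- The reals are only used through this interface: _≈ᴿ_ unfolds to a function
-- type, which defeats the inference of implicit arguments.
record OrderedℚAlgebra : Set₁ where
  infix 4 _≤_
  field
    commutativeRing : CommutativeRing 0ℓ 0ℓ
  open CommutativeRing commutativeRing public
  field
    _≤_         : Carrier → Carrier → Set
    ≤-reflexive : ∀ {x y} → x ≈ y → x ≤ y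
    ≤-trans     : ∀ {x y z} → x ≤ y → y ≤ z → x ≤ z
    +-mono-≤    : ∀ {x y u v} → x ≤ y → u ≤ v → x + u ≤ y + v
    *-nonNeg    : ∀ {x y} → 0# ≤ x → 0# ≤ y → 0# ≤ x * y
    square-nonNeg : ∀ x → 0# ≤ x * x
    ι           : ℚ → Carrier
    ι-mono-≤    : ∀ {p q} → p ℚ.≤ q → ι p ≤ ι q
    ι-homo-+    : ∀ p q → ι (p ℚ.+ q) ≈ ι p + ι q
    ι-homo-*    : ∀ p q → ι (p ℚ.* q) ≈ ι p * ι q
    ι-homo-neg  : ∀ p → ι (ℚ.- p) ≈ - ι p
    ι-homo-0    : ι 0ℚ ≈ 0#
    ι-homo-1    : ι 1ℚ ≈ 1#
    -- The positive rational lower bound q of x is the constructive form of x > 0.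
    *-cancel-nonNeg : ∀ {q x y} → 0ℚ ℚ.< q → ι q ≤ x → 0# ≤ x * y → 0# ≤ y

module Ordered (R : OrderedℚAlgebra) where
  open OrderedℚAlgebra R hiding (zero)

  module Sum = CommutativeMonoidSum +-commutativeMonoid
  open Sum using (sum; sum-cong-≋; ∑-distrib-+; ∑-comm) public
  open SemiringSum semiring using (*-distribˡ-sum; *-distribʳ-sum) public

  ι-≟ : ∀ p q → Maybe (ι p ≈ ι q)
  ι-≟ p q with p ℚ.≟ q
  ... | yes ≡.refl = just refl
  ... | no _       = nothing

  ι-morphism : ℚ.+-*-rawRing -Raw-AlmostCommutative⟶ fromCommutativeRing commutativeRing
  ι-morphism = record
    { ⟦_⟧ = ι ; +-homo = ι-homo-+ ; *-homo = ι-homo-* ; -‿homo = ι-homo-neg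
    ; 0-homo = ι-homo-0 ; 1-homo = ι-homo-1 }

  module Solver =
    RingSolver ℚ.+-*-rawRing (fromCommutativeRing commutativeRing) ι-morphism ι-≟
  open Solver using (solve; _:+_; _:*_; _:-_; :-_; _:=_; con)

  -- Numerals pass through `ι` so that the ring solver can treat them as coefficients, written
  -- `# n`.
  ν : ℕ → Carrier
  ν n = ι (+ n / 1)

  #_ : ∀ {k} → ℕ → Solver.Polynomial k
  # n = con (+ n / 1)

  ≤-refl : ∀ {x} → x ≤ x
  ≤-refl = ≤-reflexive refl

  ≤-preorder : Preorder 0ℓ 0ℓ 0ℓ
  ≤-preorder = record
    { isPreorder = record
      { isEquivalence = isEquivalence ; reflexive = ≤-reflexive ; trans = ≤-trans } }

  module ≤-Reasoning = PreorderReasoning ≤-preorder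

  ≤-respˡ-≈ : ∀ {x y z} → x ≈ y → y ≤ z → x ≤ z
  ≤-respˡ-≈ p q = ≤-trans (≤-reflexive p) q

  ≤-respʳ-≈ : ∀ {x y z} → y ≈ z → x ≤ y → x ≤ z
  ≤-respʳ-≈ p q = ≤-trans q (≤-reflexive p)

  x≤y⇒0≤y-x : ∀ {x y} → x ≤ y → 0# ≤ y - x
  x≤y⇒0≤y-x {x} x≤y = ≤-respˡ-≈ (sym (-‿inverseʳ x)) (+-mono-≤ x≤y ≤-refl)

  x≤x+y : ∀ {x y} → 0# ≤ y → x ≤ x + y
  x≤x+y {x} 0≤y = ≤-respˡ-≈ (sym (+-identityʳ x)) (+-mono-≤ ≤-refl 0≤y)

  0≤y-x⇒x≤y : ∀ {x y} → 0# ≤ y - x → x ≤ y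
  0≤y-x⇒x≤y {x} {y} 0≤y-x = ≤-respʳ-≈
    (solve 2 (λ x y → x :+ (y :- x) := y) refl x y) (x≤x+y 0≤y-x)

  +-nonNeg : ∀ {x y} → 0# ≤ x → 0# ≤ y → 0# ≤ x + y
  +-nonNeg p q = ≤-respˡ-≈ (sym (+-identityˡ 0#)) (+-mono-≤ p q)

  *-monoʳ-≤ : ∀ {x y z} → 0# ≤ z → x ≤ y → x * z ≤ y * z
  *-monoʳ-≤ {x} {y} {z} 0≤z x≤y = 0≤y-x⇒x≤y (≤-respʳ-≈
    (solve 3 (λ x y z → (y :- x) :* z := y :* z :- x :* z) refl x y z)
    (*-nonNeg (x≤y⇒0≤y-x x≤y) 0≤z))

  *-mono-≤ : ∀ {x y u v} → 0# ≤ x → 0# ≤ v → x ≤ y → u ≤ v → x * u ≤ y * v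
  *-mono-≤ {x} {y} {u} {v} 0≤x 0≤v x≤y u≤v = ≤-trans
    (≤-respʳ-≈ (*-comm v x) (≤-respˡ-≈ (*-comm x u) (*-monoʳ-≤ 0≤x u≤v)))
    (*-monoʳ-≤ 0≤v x≤y)

  ν-0 : ν 0 ≈ 0#
  ν-0 = ι-homo-0

  ν-1 : ν 1 ≈ 1#
  ν-1 = ι-homo-1

  ν-+ : ∀ a b → ν (a ℕ.+ b) ≈ ν a + ν b
  ν-+ a b = trans (reflexive (≡.cong ι (/1-homo-+ a b))) (ι-homo-+ _ _)

  ν-* : ∀ a b → ν (a ℕ.* b) ≈ ν a * ν b
  ν-* a b = trans (reflexive (≡.cong ι (/1-homo-* a b))) (ι-homo-* _ _)

  ν-suc : ∀ n → ν (suc n) ≈ 1# + ν n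
  ν-suc n = trans (ν-+ 1 n) (+-congʳ ν-1)

  0≤ι : ∀ {q} → 0ℚ ℚ.≤ q → 0# ≤ ι q
  0≤ι 0≤q = ≤-respˡ-≈ (sym ι-homo-0) (ι-mono-≤ 0≤q)

  0≤ν : ∀ n → 0# ≤ ν n
  0≤ν n = 0≤ι (ℚ.nonNegative⁻¹ (+ n / 1) {{ℚ.normalize-nonNeg n 1}})

  0≤1 : 0# ≤ 1#
  0≤1 = ≤-respʳ-≈ ν-1 (0≤ν 1)

  ν-mono-≤ : ∀ {a b} → a ℕ.≤ b → ν a ≤ ν b
  ν-mono-≤ {a} {b} a≤b with ℕ.m≤n⇒∃[o]m+o≡n a≤b
  ... | c , ≡.refl = ≤-respʳ-≈ (sym (ν-+ a c)) (x≤x+y (0≤ν c))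

  -- The substitute for division by a positive integer. The factor `x` is only required to equal
  -- `ν n` up to `_≈_`, since it mostly occurs as a square or a power.
  *-cancelˡ-nonNeg : ∀ {x y} n → .{{NonZero n}} → x ≈ ν n → 0# ≤ x * y → 0# ≤ y
  *-cancelˡ-nonNeg {x} {y} n x≈n = *-cancel-nonNeg
    (ℚ.positive⁻¹ (+ n / 1) {{ℚ.normalize-pos n 1}}) (≤-reflexive (sym x≈n))

  sum-mono-≤ : ∀ {n} {f g : Fin n → Carrier} → (∀ i → f i ≤ g i) → sum f ≤ sum g
  sum-mono-≤ {zero}  f≤g = ≤-refl
  sum-mono-≤ {suc n} f≤g = +-mono-≤ (f≤g zero) (sum-mono-≤ (λ i → f≤g (suc i)))

  sum-nonNeg : ∀ {n} {f : Fin n → Carrier} → (∀ i → 0# ≤ f i) → 0# ≤ sum f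
  sum-nonNeg {zero}  0≤f = ≤-refl
  sum-nonNeg {suc n} 0≤f = +-nonNeg (0≤f zero) (sum-nonNeg (λ i → 0≤f (suc i)))

  term≤sum : ∀ {n} {f : Fin n → Carrier} → (∀ i → 0# ≤ f i) → ∀ i → f i ≤ sum f
  term≤sum 0≤f zero    = x≤x+y (sum-nonNeg (λ i → 0≤f (suc i)))
  term≤sum 0≤f (suc i) = ≤-trans (term≤sum (λ i → 0≤f (suc i)) i)
    (≤-respʳ-≈ (+-comm _ _) (x≤x+y (0≤f zero)))

  sum-const : ∀ n x → sum {n} (λ _ → x) ≈ ν n * x
  sum-const zero    x = sym (trans (*-congʳ ν-0) (zeroˡ x))
  sum-const (suc n) x = begin
    x + sum {n} (λ _ → x)  ≈⟨ +-cong (sym (*-identityˡ x)) (sum-const n x) ⟩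
    1# * x + ν n * x       ≈⟨ distribʳ x 1# (ν n) ⟨
    (1# + ν n) * x         ≈⟨ *-congʳ (ν-suc n) ⟨
    ν (suc n) * x          ∎
    where open import Relation.Binary.Reasoning.Setoid setoid

  sum-++ : ∀ a b (f : ℕ → Carrier) →
    sum {a ℕ.+ b} (λ i → f (toℕ i)) ≈ sum {a} (λ i → f (toℕ i)) + sum {b} (λ i → f (a ℕ.+ toℕ i))
  sum-++ zero    b f = sym (+-identityˡ _)
  sum-++ (suc a) b f = trans (+-congˡ (sum-++ a b (λ i → f (suc i)))) (sym (+-assoc _ _ _))

  -- The Iverson bracket. Branching on `does` makes it agree by definition with the entries of
  -- `adjacencyMatrix` over the reals.
  [_] : ∀ {P : Set} → Dec P → Carrier
  [ d ] = if does d then 1# else 0#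

  [yes] : ∀ {P : Set} (d : Dec P) → P → [ d ] ≈ 1#
  [yes] (yes _) _ = refl
  [yes] (no ¬p) p = contradiction p ¬p

  [no] : ∀ {P : Set} (d : Dec P) → ¬ P → [ d ] ≈ 0#
  [no] (yes p) ¬p = contradiction p ¬p
  [no] (no _)  _  = refl

  0≤[] : ∀ {P : Set} (d : Dec P) → 0# ≤ [ d ]
  0≤[] (yes _) = 0≤1
  0≤[] (no _)  = ≤-refl

  sum-zero : ∀ {n} {f : Fin n → Carrier} → (∀ i → f i ≈ 0#) → sum f ≈ 0#
  sum-zero {n} f≈0 = trans (sum-cong-≋ f≈0) (Sum.sum-replicate-zero n)

  sum-select : ∀ {n} (v : Fin n) (f : Fin n → Carrier) → sum (λ u → [ u Fin.≟ v ] * f u) ≈ f v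
  sum-select zero f = trans
    (+-cong (*-identityˡ (f zero)) (sum-zero (λ i → zeroˡ (f (suc i))))) (+-identityʳ (f zero))
  sum-select (suc v) f = trans
    (+-cong (zeroˡ (f zero)) (sum-select v (λ i → f (suc i)))) (+-identityˡ (f (suc v)))

-- Block sizes and the action of the adjacency matrix on block-constant vectors.

module Blocks (R : OrderedℚAlgebra) (n k : ℕ) (2≤k : 2 ℕ.≤ k) where
  open OrderedℚAlgebra R hiding (zero)
  open Ordered R
  open Solver using (solve; _:+_; _:*_; _:-_; :-_; _:=_; con)
  open import Relation.Binary.Reasoning.Setoid setoid

  m : ℕ
  m = k ∸ 1

  instance
    m≢0 : NonZero m
    m≢0 = k∸1≢0 2≤k

  t : ℕ
  t = n ℕ./ m

  V : Fin n → ℕ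
  V = block k 2≤k

  Γ : Graph n
  Γ = G n k 2≤k

  V≤t : ∀ u → V u ℕ.≤ t
  V≤t u = ℕ./-monoˡ-≤ m (ℕ.<⇒≤ (Fin.toℕ<n u))

  n≤[1+t]m : n ℕ.≤ suc t ℕ.* m
  n≤[1+t]m = ℕ.≤-trans (ℕ.≤-reflexive (ℕ.m≡m%n+[m/n]*n n m))
    (ℕ.+-monoˡ-≤ (t ℕ.* m) (ℕ.<⇒≤ (ℕ.m%n<n n m)))

  private
    [jm+i]/m : ∀ j i → (j ℕ.* m ℕ.+ i) ℕ./ m ≡ j ℕ.+ i ℕ./ m
    [jm+i]/m j i = ≡.trans (ℕ.+-distrib-/-∣ˡ i {m} (ℕ.n∣m*n j))
      (≡.cong (ℕ._+ i ℕ./ m) (ℕ.m*n/n≡m j m))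

    [m+i]/m : ∀ i → (m ℕ.+ i) ℕ./ m ≡ suc (i ℕ./ m)
    [m+i]/m i = ≡.trans (ℕ.+-distrib-/-∣ˡ i {m} ℕ.∣-refl) (≡.cong (ℕ._+ i ℕ./ m) (ℕ.n/n≡1 m))

  -- The length has the form `j * m + (m + c)` so that `sum-++` cuts the range into the indices
  -- before, inside and after block `j`.
  count-quotient : ∀ j c →
    sum {j ℕ.* m ℕ.+ (m ℕ.+ c)} (λ u → [ toℕ u ℕ./ m ℕ.≟ j ]) ≈ ν m
  count-quotient j c = begin
    sum {j ℕ.* m ℕ.+ (m ℕ.+ c)} (λ u → q (toℕ u))
      ≈⟨ sum-++ (j ℕ.* m) (m ℕ.+ c) q ⟩
    sum {j ℕ.* m} (λ u → q (toℕ u)) + sum {m ℕ.+ c} (λ u → q (j ℕ.* m ℕ.+ toℕ u))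
      ≈⟨ +-cong (sum-zero below) (sum-++ m c (λ i → q (j ℕ.* m ℕ.+ i))) ⟩
    0# + (sum {m} (λ u → q (j ℕ.* m ℕ.+ toℕ u)) + sum {c} (λ u → q (j ℕ.* m ℕ.+ (m ℕ.+ toℕ u))))
      ≈⟨ +-congˡ (+-cong (sum-cong-≋ inside) (sum-zero above)) ⟩
    0# + (sum {m} (λ _ → 1#) + 0#)
      ≈⟨ trans (+-identityˡ _) (+-identityʳ _) ⟩
    sum {m} (λ _ → 1#)
      ≈⟨ trans (sum-const m 1#) (*-identityʳ (ν m)) ⟩
    ν m ∎
    where
    q : ℕ → Carrier
    q i = [ i ℕ./ m ℕ.≟ j ]
    below : ∀ (u : Fin (j ℕ.* m)) → q (toℕ u) ≈ 0#
    below u = [no] (_ ℕ.≟ _) (ℕ.<⇒≢ (ℕ.m<n*o⇒m/o<n {n = j} (Fin.toℕ<n u)))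
    inside : ∀ (u : Fin m) → q (j ℕ.* m ℕ.+ toℕ u) ≈ 1#
    inside u = [yes] (_ ℕ.≟ _) (≡.trans ([jm+i]/m j (toℕ u))
      (≡.trans (≡.cong (j ℕ.+_) (ℕ.m<n⇒m/n≡0 (Fin.toℕ<n u))) (ℕ.+-identityʳ j)))
    above : ∀ (u : Fin c) → q (j ℕ.* m ℕ.+ (m ℕ.+ toℕ u)) ≈ 0#
    above u = [no] (_ ℕ.≟ _) λ eq → ℕ.m≢1+m+n j (≡.trans (≡.sym eq)
      (≡.trans ([jm+i]/m j (m ℕ.+ toℕ u))
        (≡.trans (≡.cong (j ℕ.+_) ([m+i]/m (toℕ u))) (ℕ.+-suc j _))))

  size : ℕ → Carrier
  size j = sum (λ u → [ V u ℕ.≟ j ])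

  size≈m : ∀ {j} → j ℕ.< t → size j ≈ ν m
  size≈m {j} j<t with ℕ.m≤n⇒∃[o]m+o≡n (ℕ.≤-trans (ℕ.*-monoˡ-≤ m j<t) (ℕ.m/n*n≤m n m))
  ... | c , eq = ≡.subst (λ N → sum {N} (λ u → [ toℕ u ℕ./ m ℕ.≟ j ]) ≈ ν m)
    (≡.trans (≡.trans (≡.sym (ℕ.+-assoc (j ℕ.* m) m c)) (≡.cong (ℕ._+ c) (ℕ.+-comm (j ℕ.* m) m))) eq)
    (count-quotient j c)

  A : Fin n → Fin n → Carrier
  A u v = [ Graph.adj? Γ u v ]

  A-suc : ∀ {j} u v → V v ≡ suc j → A u v ≈ [ V u ℕ.≟ j ] + [ V u ℕ.≟ 2 ℕ.+ j ]
  A-suc {j} u v Vv≡1+j with V u ℕ.≟ j | V u ℕ.≟ 2 ℕ.+ j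
  ... | yes p | yes q = contradiction (≡.trans (≡.sym p) q) (ℕ.<⇒≢ (ℕ.m<n⇒m<1+n ℕ.≤-refl))
  ... | yes p | no ¬q = begin
    A u v    ≈⟨ [yes] (Graph.adj? Γ u v) (inj₁ (inj₁ (≡.trans Vv≡1+j (≡.cong suc (≡.sym p))))) ⟩
    1#       ≈⟨ +-identityʳ 1# ⟨
    1# + 0#  ≈⟨ +-cong ([yes] (V u ℕ.≟ j) p) ([no] (V u ℕ.≟ 2 ℕ.+ j) ¬q) ⟨
    [ V u ℕ.≟ j ] + [ V u ℕ.≟ 2 ℕ.+ j ] ∎
  ... | no ¬p | yes q = begin
    A u v    ≈⟨ [yes] (Graph.adj? Γ u v) (inj₁ (inj₂ (≡.trans q (≡.cong suc (≡.sym Vv≡1+j))))) ⟩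
    1#       ≈⟨ +-identityˡ 1# ⟨
    0# + 1#  ≈⟨ +-cong ([no] (V u ℕ.≟ j) ¬p) ([yes] (V u ℕ.≟ 2 ℕ.+ j) q) ⟨
    [ V u ℕ.≟ j ] + [ V u ℕ.≟ 2 ℕ.+ j ] ∎
  ... | no ¬p | no ¬q = begin
    A u v    ≈⟨ [no] (Graph.adj? Γ u v) (λ where
      (inj₁ (inj₁ e)) → ¬p (ℕ.suc-injective (≡.trans (≡.sym e) Vv≡1+j))
      (inj₁ (inj₂ e)) → ¬q (≡.trans e (≡.cong suc Vv≡1+j))
      (inj₂ (_ , e , _)) → ℕ.1+n≢0 (≡.trans (≡.sym Vv≡1+j) e)) ⟩
    0#       ≈⟨ +-identityˡ 0# ⟨
    0# + 0#  ≈⟨ +-cong ([no] (V u ℕ.≟ j) ¬p) ([no] (V u ℕ.≟ 2 ℕ.+ j) ¬q) ⟨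
    [ V u ℕ.≟ j ] + [ V u ℕ.≟ 2 ℕ.+ j ] ∎

  -- A clique has no loops; adding the missing one at `v` makes the column of `v` constant on each
  -- block.
  A-zero : ∀ u v → V v ≡ 0 → A u v + [ u Fin.≟ v ] ≈ [ V u ℕ.≟ 0 ] + [ V u ℕ.≟ 1 ]
  A-zero u v Vv≡0 = split (u Fin.≟ v)
    where
    split : Dec (u ≡ v) → A u v + [ u Fin.≟ v ] ≈ [ V u ℕ.≟ 0 ] + [ V u ℕ.≟ 1 ]
    split (yes u≡v) = begin
      A u v + [ u Fin.≟ v ]
        ≈⟨ +-cong ([no] (Graph.adj? Γ u v) (Graph.irrefl Γ u≡v)) ([yes] (u Fin.≟ v) u≡v) ⟩
      0# + 1#
        ≈⟨ +-comm 0# 1# ⟩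
      1# + 0#
        ≈⟨ +-cong ([yes] (V u ℕ.≟ 0) Vu≡0) ([no] (V u ℕ.≟ 1) λ e → ℕ.0≢1+n (≡.trans (≡.sym Vu≡0) e)) ⟨
      [ V u ℕ.≟ 0 ] + [ V u ℕ.≟ 1 ] ∎
      where
      Vu≡0 : V u ≡ 0
      Vu≡0 = ≡.trans (≡.cong V u≡v) Vv≡0
    split (no u≢v) = begin
      A u v + [ u Fin.≟ v ]          ≈⟨ +-congˡ ([no] (u Fin.≟ v) u≢v) ⟩
      A u v + 0#                     ≈⟨ +-identityʳ (A u v) ⟩
      A u v                          ≈⟨ cases ⟩
      [ V u ℕ.≟ 0 ] + [ V u ℕ.≟ 1 ]  ∎
      where
      cases : A u v ≈ [ V u ℕ.≟ 0 ] + [ V u ℕ.≟ 1 ]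
      cases with V u ℕ.≟ 0 | V u ℕ.≟ 1
      ... | yes p | yes q = contradiction (≡.trans (≡.sym p) q) λ ()
      ... | yes p | no ¬q = begin
        A u v    ≈⟨ [yes] (Graph.adj? Γ u v) (inj₂ (p , Vv≡0 , u≢v)) ⟩
        1#       ≈⟨ +-identityʳ 1# ⟨
        1# + 0#  ≈⟨ +-cong ([yes] (V u ℕ.≟ 0) p) ([no] (V u ℕ.≟ 1) ¬q) ⟨
        [ V u ℕ.≟ 0 ] + [ V u ℕ.≟ 1 ] ∎
      ... | no ¬p | yes q = begin
        A u v    ≈⟨ [yes] (Graph.adj? Γ u v) (inj₁ (inj₂ (≡.trans q (≡.cong suc (≡.sym Vv≡0))))) ⟩
        1#       ≈⟨ +-identityˡ 1# ⟨
        0# + 1#  ≈⟨ +-cong ([no] (V u ℕ.≟ 0) ¬p) ([yes] (V u ℕ.≟ 1) q) ⟨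
        [ V u ℕ.≟ 0 ] + [ V u ℕ.≟ 1 ] ∎
      ... | no ¬p | no ¬q = begin
        A u v    ≈⟨ [no] (Graph.adj? Γ u v) (λ where
          (inj₁ (inj₁ e)) → ℕ.0≢1+n (≡.trans (≡.sym Vv≡0) e)
          (inj₁ (inj₂ e)) → ¬q (≡.trans e (≡.cong suc Vv≡0))
          (inj₂ (e , _)) → ¬p e) ⟩
        0#       ≈⟨ +-identityˡ 0# ⟨
        0# + 0#  ≈⟨ +-cong ([no] (V u ℕ.≟ 0) ¬p) ([no] (V u ℕ.≟ 1) ¬q) ⟨
        [ V u ℕ.≟ 0 ] + [ V u ℕ.≟ 1 ] ∎

  -- Positivity of an entry is stored as a positive rational lower bound, the form in which
  -- `*-cancel-nonNeg` can cancel it.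
  record PositiveEigenvector : Set where
    field
      x     : Fin n → Carrier
      ρ     : Carrier
      eigen : ∀ u → sum (λ v → A u v * x v) ≈ ρ * x u
      x-pos : ∀ u → ∃[ q ] 0ℚ ℚ.< q × ι q ≤ x u
      unit  : sum (λ u → x u * x u) ≈ 1#

  -- Here `f` multiplies `A` from the left, so that pairing with `x` moves `A` onto `x` by
  -- exchanging two sums.
  col : (Fin n → Carrier) → Fin n → Carrier
  col f v = sum (λ u → f u * A u v)

  sum-block : ∀ (z : ℕ → Carrier) j → sum (λ u → z (V u) * [ V u ℕ.≟ j ]) ≈ size j * z j
  sum-block z j = trans (sum-cong-≋ at) (sym (*-distribʳ-sum {n} (z j) _))
    where
    at : ∀ u → z (V u) * [ V u ℕ.≟ j ] ≈ [ V u ℕ.≟ j ] * z j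
    at u with V u ℕ.≟ j
    ... | yes eq = trans (*-comm (z (V u)) _) (*-congˡ (reflexive (≡.cong z eq)))
    ... | no ¬eq = trans (*-congˡ [≟]≈0) (trans (zeroʳ (z (V u))) (sym (trans (*-congʳ [≟]≈0) (zeroˡ (z j)))))
      where
      [≟]≈0 : [ V u ℕ.≟ j ] ≈ 0#
      [≟]≈0 = [no] (V u ℕ.≟ j) ¬eq

  -- A vector that vanishes from index `t` on does not see the possibly short block `V_t`, so
  -- `size j` may be replaced by `ν m` in every block sum.
  module Col (z : ℕ → Carrier) (z-vanishes : ∀ {j} → t ℕ.≤ j → z j ≈ 0#) where

    size*z : ∀ j → size j * z j ≈ ν m * z j
    size*z j with j ℕ.<? t
    ... | yes j<t = *-congʳ (size≈m j<t)
    ... | no j≮t  = trans (*-congˡ z≈0) (trans (zeroʳ _) (sym (trans (*-congˡ z≈0) (zeroʳ _))))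
      where
      z≈0 : z j ≈ 0#
      z≈0 = z-vanishes (ℕ.≮⇒≥ j≮t)

    two-blocks : ∀ i j →
      sum (λ u → z (V u) * ([ V u ℕ.≟ i ] + [ V u ℕ.≟ j ])) ≈ ν m * (z i + z j)
    two-blocks i j = begin
      sum (λ u → z (V u) * ([ V u ℕ.≟ i ] + [ V u ℕ.≟ j ]))
        ≈⟨ sum-cong-≋ (λ u → distribˡ (z (V u)) _ _) ⟩
      sum (λ u → z (V u) * [ V u ℕ.≟ i ] + z (V u) * [ V u ℕ.≟ j ])
        ≈⟨ ∑-distrib-+ {n} _ _ ⟩
      sum (λ u → z (V u) * [ V u ℕ.≟ i ]) + sum (λ u → z (V u) * [ V u ℕ.≟ j ])
        ≈⟨ +-cong (trans (sum-block z i) (size*z i)) (trans (sum-block z j) (size*z j)) ⟩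
      ν m * z i + ν m * z j
        ≈⟨ distribˡ (ν m) (z i) (z j) ⟨
      ν m * (z i + z j) ∎

    col-suc : ∀ {j} v → V v ≡ suc j → col (λ u → z (V u)) v ≈ ν m * (z j + z (2 ℕ.+ j))
    col-suc {j} v eq = trans (sum-cong-≋ (λ u → *-congˡ (A-suc u v eq))) (two-blocks j (2 ℕ.+ j))

    col-zero : ∀ v → V v ≡ 0 → col (λ u → z (V u)) v + z 0 ≈ ν m * (z 0 + z 1)
    col-zero v eq = begin
      col (λ u → z (V u)) v + z 0
        ≈⟨ +-congˡ (trans (sum-select v (λ u → z (V u))) (reflexive (≡.cong z eq))) ⟨
      col (λ u → z (V u)) v + sum (λ u → [ u Fin.≟ v ] * z (V u))
        ≈⟨ ∑-distrib-+ {n} _ _ ⟨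
      sum (λ u → z (V u) * A u v + [ u Fin.≟ v ] * z (V u))
        ≈⟨ sum-cong-≋ (λ u → trans (+-congˡ (*-comm _ _)) (trans (sym (distribˡ _ _ _))
             (*-congˡ (A-zero u v eq)))) ⟩
      sum (λ u → z (V u) * ([ V u ℕ.≟ 0 ] + [ V u ℕ.≟ 1 ]))
        ≈⟨ two-blocks 0 1 ⟩
      ν m * (z 0 + z 1) ∎

-- Lower bounds for the eigenvalue and an upper bound for the sum over V₀.

module Perron (R : OrderedℚAlgebra) (n k : ℕ) (2≤k : 2 ℕ.≤ k)
  (2m≤n : 2 ℕ.* (k ∸ 1) ℕ.≤ n) (P : Blocks.PositiveEigenvector R n k 2≤k) where
  open OrderedℚAlgebra R hiding (zero)
  open Ordered R
  open Blocks R n k 2≤k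
  open PositiveEigenvector P
  open Solver using (solve; _:+_; _:*_; _:-_; :-_; _:=_; con)

  0≤x : ∀ u → 0# ≤ x u
  0≤x u with x-pos u
  ... | q , 0<q , q≤x = ≤-trans (0≤ι (ℚ.<⇒≤ 0<q)) q≤x

  2≤t : 2 ℕ.≤ t
  2≤t = ℕ.≤-trans (ℕ.≤-reflexive (≡.sym (ℕ.m*n/n≡m 2 m))) (ℕ./-monoˡ-≤ m 2m≤n)

  instance
    n≢0 : NonZero n
    n≢0 = ℕ.>-nonZero (ℕ.≤-trans (ℕ.≤-trans (ℕ.>-nonZero⁻¹ m) (ℕ.m≤m+n m _)) 2m≤n)

  u₀ : Fin n
  u₀ = fromℕ< (ℕ.>-nonZero⁻¹ n)

  V-u₀ : V u₀ ≡ 0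
  V-u₀ = ≡.trans (≡.cong (ℕ._/ m) (Fin.toℕ-fromℕ< (ℕ.>-nonZero⁻¹ n))) (ℕ.0/n≡0 m)

  ⟨_⟩ : (Fin n → Carrier) → Carrier
  ⟨ f ⟩ = sum (λ u → f u * x u)

  ⟨⟩-mono : ∀ {f g} → (∀ u → f u ≤ g u) → ⟨ f ⟩ ≤ ⟨ g ⟩
  ⟨⟩-mono f≤g = sum-mono-≤ (λ u → *-monoʳ-≤ (0≤x u) (f≤g u))

  ⟨⟩-nonNeg : ∀ {f} → (∀ u → 0# ≤ f u) → 0# ≤ ⟨ f ⟩
  ⟨⟩-nonNeg 0≤f = sum-nonNeg (λ u → *-nonNeg (0≤f u) (0≤x u))

  ⟨⟩-scale : ∀ c f → ⟨ (λ u → c * f u) ⟩ ≈ c * ⟨ f ⟩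
  ⟨⟩-scale c f = trans (sum-cong-≋ (λ u → *-assoc c (f u) (x u))) (sym (*-distribˡ-sum {n} c _))

  ⟨⟩-+ : ∀ f g → ⟨ (λ u → f u + g u) ⟩ ≈ ⟨ f ⟩ + ⟨ g ⟩
  ⟨⟩-+ f g = trans (sum-cong-≋ (λ u → distribʳ (x u) (f u) (g u))) (∑-distrib-+ {n} _ _)

  ⟨col⟩ : ∀ f → ⟨ col f ⟩ ≈ ρ * ⟨ f ⟩
  ⟨col⟩ f = begin
    sum (λ v → sum (λ u → f u * A u v) * x v)
      ≈⟨ sum-cong-≋ (λ v → trans (*-distribʳ-sum {n} (x v) _)
           (sum-cong-≋ (λ u → *-assoc (f u) (A u v) (x v)))) ⟩
    sum (λ v → sum (λ u → f u * (A u v * x v)))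
      ≈⟨ ∑-comm (λ v u → f u * (A u v * x v)) ⟩
    sum (λ u → sum (λ v → f u * (A u v * x v)))
      ≈⟨ sum-cong-≋ (λ u → *-distribˡ-sum {n} (f u) _) ⟨
    sum (λ u → f u * sum (λ v → A u v * x v))
      ≈⟨ sum-cong-≋ (λ u → trans (*-congˡ (eigen u))
           (solve 3 (λ f ρ x → f :* (ρ :* x) := ρ :* (f :* x)) refl (f u) ρ (x u))) ⟩
    sum (λ u → ρ * (f u * x u))
      ≈⟨ *-distribˡ-sum {n} ρ _ ⟨
    ρ * ⟨ f ⟩ ∎
    where open import Relation.Binary.Reasoning.Setoid setoid

  -- Pairing the hypothesis with `x` gives `μ * ⟨ f ⟩ ≤ c * (ρ * ⟨ f ⟩)`, and `⟨ f ⟩` can be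
  -- cancelled because it is at least `x u`. The factor `c` allows a bound with a denominator to be
  -- used multiplied out.
  test-vector : ∀ {c μ} f → (∀ u → 0# ≤ f u) → ∀ u → 1# ≤ f u →
    (∀ v → μ * f v ≤ c * col f v) → μ ≤ c * ρ
  test-vector {c} {μ} f 0≤f u 1≤fu μf≤cAf with x-pos u
  ... | q , 0<q , q≤xu = 0≤y-x⇒x≤y (*-cancel-nonNeg 0<q q≤⟨f⟩
    (≤-respʳ-≈ (solve 4 (λ c ρ f μ → c :* (ρ :* f) :- μ :* f := f :* (c :* ρ :- μ)) refl c ρ ⟨ f ⟩ μ)
      (x≤y⇒0≤y-x μ⟨f⟩≤cρ⟨f⟩)))
    where
    open ≤-Reasoning
    q≤⟨f⟩ : ι q ≤ ⟨ f ⟩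
    q≤⟨f⟩ = begin
      ι q        ≲⟨ q≤xu ⟩
      x u        ≈⟨ *-identityˡ (x u) ⟨
      1# * x u   ≲⟨ *-monoʳ-≤ (0≤x u) 1≤fu ⟩
      f u * x u  ≲⟨ term≤sum (λ v → *-nonNeg (0≤f v) (0≤x v)) u ⟩
      ⟨ f ⟩      ∎
    μ⟨f⟩≤cρ⟨f⟩ : μ * ⟨ f ⟩ ≤ c * (ρ * ⟨ f ⟩)
    μ⟨f⟩≤cρ⟨f⟩ = begin
      μ * ⟨ f ⟩                   ≈⟨ ⟨⟩-scale μ f ⟨
      ⟨ (λ v → μ * f v) ⟩         ≲⟨ ⟨⟩-mono μf≤cAf ⟩
      ⟨ (λ v → c * col f v) ⟩     ≈⟨ ⟨⟩-scale c (col f) ⟩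
      c * ⟨ col f ⟩               ≈⟨ *-congˡ (⟨col⟩ f) ⟩
      c * (ρ * ⟨ f ⟩)             ∎

  -- At `V₀` the hypothesis counts only the neighbours in `V₁`; the clique adds `(m - 1) z₀`, which
  -- is nonnegative.
  block-test-vector : ∀ {c μ} → 0# ≤ c → (z : ℕ → Carrier) → (∀ {j} → t ℕ.≤ j → z j ≈ 0#) →
    (∀ j → 0# ≤ z j) → 1# ≤ z 0 → μ * z 0 ≤ c * (ν m * z 1) →
    (∀ j → suc j ℕ.≤ t → μ * z (suc j) ≤ c * (ν m * (z j + z (2 ℕ.+ j)))) → μ ≤ c * ρ
  block-test-vector {c} {μ} 0≤c z z-vanishes 0≤z 1≤z₀ at-0 at-suc =
    test-vector (λ u → z (V u)) (λ u → 0≤z (V u)) u₀ (≡.subst (λ i → 1# ≤ z i) (≡.sym V-u₀) 1≤z₀)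
      (λ v → at v (V v) ≡.refl)
    where
    open ≤-Reasoning
    open Col z z-vanishes
    at : ∀ v i → V v ≡ i → μ * z (V v) ≤ c * col (λ u → z (V u)) v
    at v (suc j) eq = begin
      μ * z (V v)                       ≡⟨ ≡.cong (λ i → μ * z i) eq ⟩
      μ * z (suc j)                     ≲⟨ at-suc j (≡.subst (ℕ._≤ t) eq (V≤t v)) ⟩
      c * (ν m * (z j + z (2 ℕ.+ j)))   ≈⟨ *-congˡ (col-suc v eq) ⟨
      c * col (λ u → z (V u)) v         ∎
    at v zero eq = begin
      μ * z (V v)                       ≡⟨ ≡.cong (λ i → μ * z i) eq ⟩
      μ * z 0                           ≲⟨ at-0 ⟩
      c * (ν m * z 1)                   ≲⟨ x≤x+y (*-nonNeg 0≤c (*-nonNeg (x≤y⇒0≤y-x 1≤m) (0≤z 0))) ⟩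
      c * (ν m * z 1) + c * ((ν m - 1#) * z 0)
        ≈⟨ trans (+-congˡ (*-congˡ (*-congʳ (+-congˡ (-‿cong (sym ν-1))))))
           (solve 4 (λ c m z₀ z₁ → c :* (m :* z₁) :+ c :* ((m :- # 1) :* z₀)
             := c :* (m :* (z₀ :+ z₁) :- z₀)) refl c (ν m) (z 0) (z 1)) ⟩
      c * (ν m * (z 0 + z 1) - z 0)     ≈⟨ *-congˡ (+-congʳ (col-zero v eq)) ⟨
      c * (col (λ u → z (V u)) v + z 0 - z 0)
        ≈⟨ *-congˡ (solve 2 (λ a b → a :+ b :- b := a) refl _ (z 0)) ⟩
      c * col (λ u → z (V u)) v         ∎
      where
      1≤m : 1# ≤ ν m
      1≤m = ≤-respˡ-≈ (sym ν-1) (ν-mono-≤ (ℕ.>-nonZero⁻¹ m))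

  m≤ρ : ν m ≤ ρ
  m≤ρ = ≤-respʳ-≈ (*-identityˡ ρ) (block-test-vector 0≤1 z vanishes 0≤z ≤-refl
    (≤-reflexive (sym (*-identityˡ _))) at-suc)
    where
    z : ℕ → Carrier
    z 0 = 1#
    z 1 = 1#
    z (suc (suc _)) = 0#
    0≤z : ∀ j → 0# ≤ z j
    0≤z 0 = 0≤1
    0≤z 1 = 0≤1
    0≤z (suc (suc _)) = ≤-refl
    vanishes : ∀ {j} → t ℕ.≤ j → z j ≈ 0#
    -- The support `V₀ ∪ V₁` consists of full blocks because `2 ≤ t`, which is where `n ≥ 2(k - 1)`
    -- enters.
    vanishes t≤j with ℕ.≤-trans 2≤t t≤j
    ... | s≤s (s≤s _) = refl
    at-suc : ∀ j → suc j ℕ.≤ t → ν m * z (suc j) ≤ 1# * (ν m * (z j + z (2 ℕ.+ j)))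
    at-suc zero    _ = ≤-reflexive (sym (trans (*-identityˡ _) (*-congˡ (+-identityʳ 1#))))
    at-suc (suc j) _ = ≤-respˡ-≈ (zeroʳ (ν m))
      (*-nonNeg 0≤1 (*-nonNeg (0≤ν m) (+-nonNeg (0≤z (suc j)) ≤-refl)))

  T : Carrier
  T = ν (suc t)

  -- With u = (1 + a)(1 + b) and T = a + b + 2 the difference of the two sides
  -- is M (2 (3u - T²)² + 2T²), so u² is a test vector for 2 - 18 / T².
  quartic-superharmonic : ∀ M a b → 0# ≤ M → let s = ν 2 + a + b in
    let sq = λ y → y * y in
    M * (ν 2 * sq s - ν 18) * sq ((ν 1 + a) * (ν 1 + b)) ≤
    sq s * (M * (sq (a * (ν 2 + b)) + sq ((ν 2 + a) * b)))
  quartic-superharmonic M a b 0≤M = 0≤y-x⇒x≤y (≤-respʳ-≈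
    (solve 3 (λ M a b →
      let sq = λ y → y :* y
          s = # 2 :+ a :+ b
          u = (# 1 :+ a) :* (# 1 :+ b)
      in M :* (# 2 :* sq (# 3 :* u :- sq s) :+ # 2 :* sq s) :=
         sq s :* (M :* (sq (a :* (# 2 :+ b)) :+ sq ((# 2 :+ a) :* b)))
           :- M :* (# 2 :* sq s :- # 18) :* sq u)
      refl M a b)
    (*-nonNeg 0≤M (+-nonNeg (*-nonNeg (0≤ν 2) (square-nonNeg _)) (*-nonNeg (0≤ν 2) (square-nonNeg _)))))

  -- The parabola with zeros at -1 and `t`; its square is the test vector.
  bump : ℕ → ℕ
  bump i = suc i ℕ.* (t ∸ i)

  bump≡ : ∀ i d → i ℕ.+ d ≡ t → bump i ≡ suc i ℕ.* d
  bump≡ i d eq = ≡.cong (suc i ℕ.*_) (≡.trans (≡.cong (_∸ i) (≡.sym eq)) (ℕ.m+n∸m≡n i d))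

  sq : Carrier → Carrier
  sq y = y * y

  sq-cong : ∀ {y y′} → y ≈ y′ → sq y ≈ sq y′
  sq-cong eq = *-cong eq eq

  -- Writing `t = i + 1 + d` removes truncated subtraction: `i * (2 + d)` and `(2 + i) * d` are the
  -- bump values at the two neighbours of `i`. The first is 0 at `i = 0`, which matches the absence
  -- of a block before `V₀`.
  bump-superharmonic : ∀ i d → i ℕ.+ suc d ≡ t →
    ν m * (ν 2 * sq T - ν 18) * sq (ν (suc i ℕ.* suc d)) ≤
    sq T * (ν m * (sq (ν (i ℕ.* (2 ℕ.+ d))) + sq (ν ((2 ℕ.+ i) ℕ.* d))))
  bump-superharmonic i d eq = begin
    ν m * (ν 2 * sq T - ν 18) * sq (ν (suc i ℕ.* suc d))
      ≈⟨ *-cong (*-congˡ (+-congʳ (*-congˡ (sq-cong T≈))))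
           (sq-cong (trans (ν-* (suc i) (suc d)) (*-cong (ν-+ 1 i) (ν-+ 1 d)))) ⟩
    ν m * (ν 2 * sq s - ν 18) * sq ((ν 1 + ν i) * (ν 1 + ν d))
      ≲⟨ quartic-superharmonic (ν m) (ν i) (ν d) (0≤ν m) ⟩
    sq s * (ν m * (sq (ν i * (ν 2 + ν d)) + sq ((ν 2 + ν i) * ν d)))
      ≈⟨ *-cong (sq-cong T≈) (*-congˡ (+-cong
           (sq-cong (trans (ν-* i (2 ℕ.+ d)) (*-congˡ (ν-+ 2 d))))
           (sq-cong (trans (ν-* (2 ℕ.+ i) d) (*-congʳ (ν-+ 2 i)))))) ⟨
    sq T * (ν m * (sq (ν (i ℕ.* (2 ℕ.+ d))) + sq (ν ((2 ℕ.+ i) ℕ.* d)))) ∎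
    where
    open ≤-Reasoning
    s : Carrier
    s = ν 2 + ν i + ν d
    T≈ : T ≈ s
    T≈ = trans (reflexive (≡.cong ν (≡.trans (≡.cong suc (≡.sym eq)) (≡.cong suc (ℕ.+-suc i d)))))
      (trans (ν-+ (2 ℕ.+ i) d) (+-congʳ (ν-+ 2 i)))

  [2T²-18]m≤T²ρ : ν m * (ν 2 * sq T - ν 18) ≤ sq T * ρ
  [2T²-18]m≤T²ρ = block-test-vector (square-nonNeg T) z vanishes (λ j → square-nonNeg (ν (bump j)))
    1≤z₀ at-0 at-suc
    where
    open ≤-Reasoning
    z : ℕ → Carrier
    z i = sq (ν (bump i))
    vanishes : ∀ {j} → t ℕ.≤ j → z j ≈ 0#
    vanishes {j} t≤j = trans (*-congʳ (trans (reflexive (≡.cong ν bump≡0)) ν-0)) (zeroˡ _)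
      where
      bump≡0 : bump j ≡ 0
      bump≡0 = ≡.trans (≡.cong (suc j ℕ.*_) (ℕ.m≤n⇒m∸n≡0 t≤j)) (ℕ.*-zeroʳ j)
    z≡ : ∀ i d → i ℕ.+ d ≡ t → z i ≡ sq (ν (suc i ℕ.* d))
    z≡ i d eq = ≡.cong (λ b → sq (ν b)) (bump≡ i d eq)
    1≤z₀ : 1# ≤ z 0
    1≤z₀ = ≤-respʳ-≈ (ν-* (bump 0) (bump 0)) (≤-respˡ-≈ (sym ν-1)
      (ν-mono-≤ (ℕ.*-mono-≤ 1≤bump₀ 1≤bump₀)))
      where
      1≤bump₀ : 1 ℕ.≤ bump 0
      1≤bump₀ = ℕ.≤-trans (ℕ.≤-trans (s≤s z≤n) 2≤t) (ℕ.m≤m+n t 0)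
    at-0 : ν m * (ν 2 * sq T - ν 18) * z 0 ≤ sq T * (ν m * z 1)
    at-0 with ℕ.m≤n⇒∃[o]m+o≡n (ℕ.≤-trans (s≤s z≤n) 2≤t)
    ... | d , eq = begin
      ν m * (ν 2 * sq T - ν 18) * z 0                   ≡⟨ ≡.cong (ν m * (ν 2 * sq T - ν 18) *_) (z≡ 0 (suc d) eq) ⟩
      ν m * (ν 2 * sq T - ν 18) * sq (ν (1 ℕ.* suc d))  ≲⟨ bump-superharmonic 0 d eq ⟩
      sq T * (ν m * (sq (ν 0) + sq (ν (2 ℕ.* d))))
        ≈⟨ *-congˡ (*-congˡ (trans (+-congʳ (trans (*-congʳ ν-0) (zeroˡ _))) (+-identityˡ _))) ⟩
      sq T * (ν m * sq (ν (2 ℕ.* d)))                   ≡⟨ ≡.cong (λ y → sq T * (ν m * y)) (z≡ 1 d eq) ⟨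
      sq T * (ν m * z 1)                                ∎
    at-suc : ∀ j → suc j ℕ.≤ t →
      ν m * (ν 2 * sq T - ν 18) * z (suc j) ≤ sq T * (ν m * (z j + z (2 ℕ.+ j)))
    at-suc j j<t with ℕ.m≤n⇒∃[o]m+o≡n j<t
    -- Here `suc j = t`: the left side is zero, so nonnegativity of the right side suffices.
    ... | zero , eq = begin
      ν m * (ν 2 * sq T - ν 18) * z (suc j)
        ≈⟨ trans (*-congˡ (vanishes (ℕ.≤-reflexive (≡.trans (≡.sym eq) (ℕ.+-identityʳ (suc j)))))) (zeroʳ _) ⟩
      0#
        ≲⟨ *-nonNeg (square-nonNeg T) (*-nonNeg (0≤ν m) (+-nonNeg (square-nonNeg _) (square-nonNeg _))) ⟩
      sq T * (ν m * (z j + z (2 ℕ.+ j))) ∎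
    ... | suc d , eq = begin
      ν m * (ν 2 * sq T - ν 18) * z (suc j)
        ≡⟨ ≡.cong (ν m * (ν 2 * sq T - ν 18) *_) (z≡ (suc j) (suc d) eq) ⟩
      ν m * (ν 2 * sq T - ν 18) * sq (ν ((2 ℕ.+ j) ℕ.* suc d))
        ≲⟨ bump-superharmonic (suc j) d eq ⟩
      sq T * (ν m * (sq (ν (suc j ℕ.* (2 ℕ.+ d))) + sq (ν ((3 ℕ.+ j) ℕ.* d))))
        ≡⟨ ≡.cong₂ (λ y y′ → sq T * (ν m * (y + y′)))
             (z≡ j (2 ℕ.+ d) (≡.trans (ℕ.+-suc j (suc d)) eq))
             (z≡ (2 ℕ.+ j) d (≡.trans (≡.cong suc (≡.sym (ℕ.+-suc j d))) eq)) ⟨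
      sq T * (ν m * (z j + z (2 ℕ.+ j))) ∎

  χ₀ : Fin n → Carrier
  χ₀ u = [ V u ℕ.≟ 0 ]

  parabola : ℕ → ℕ
  parabola i = (t ∸ i) ℕ.* (t ∸ i)

  -- The second difference of a square is 2 as long as no subtraction is truncated.
  parabola-convex : ∀ j → suc j ℕ.≤ t →
    parabola j ℕ.+ parabola (2 ℕ.+ j) ℕ.≤ 2 ℕ.* parabola (suc j) ℕ.+ 2
  parabola-convex j j<t with ℕ.m≤n⇒∃[o]m+o≡n j<t
  ... | d , eq = ≡.subst₂ ℕ._≤_
    (≡.cong₂ (λ p q → p ℕ.* p ℕ.+ q ℕ.* q)
      (≡.sym (t∸ j (suc d) (≡.trans (ℕ.+-suc j d) eq)))
      (≡.trans (≡.cong (_∸ 1) (≡.sym (t∸ (suc j) d eq))) (ℕ.pred[m∸n]≡m∸[1+n] t (suc j))))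
    (≡.cong (λ p → 2 ℕ.* (p ℕ.* p) ℕ.+ 2) (≡.sym (t∸ (suc j) d eq)))
    (bound d)
    where
    open ℕ.+-*-Solver using () renaming (solve to solveℕ; _:+_ to _⊕_; _:*_ to _⊗_; _:=_ to _⊜_; con to c)
    t∸ : ∀ i e → i ℕ.+ e ≡ t → t ∸ i ≡ e
    t∸ i e eq = ≡.trans (≡.cong (_∸ i) (≡.sym eq)) (ℕ.m+n∸m≡n i e)
    bound : ∀ d → suc d ℕ.* suc d ℕ.+ (d ∸ 1) ℕ.* (d ∸ 1) ℕ.≤ 2 ℕ.* (d ℕ.* d) ℕ.+ 2
    -- At `V_t` truncation turns the next value 1 into 0, so the second difference is only 1.
    bound zero    = s≤s z≤n
    bound (suc d) = ℕ.≤-reflexive (solveℕ 1 (λ d →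
      (c 2 ⊕ d) ⊗ (c 2 ⊕ d) ⊕ d ⊗ d ⊜ c 2 ⊗ ((c 1 ⊕ d) ⊗ (c 1 ⊕ d)) ⊕ c 2) ≡.refl d)

  parabola-vanishes : ∀ {j} → t ℕ.≤ j → ν (parabola j) ≈ 0#
  parabola-vanishes t≤j = trans (reflexive (≡.cong (λ d → ν (d ℕ.* d)) (ℕ.m≤n⇒m∸n≡0 t≤j))) ν-0

  W : Fin n → Carrier
  W u = ν (parabola (V u))

  -- At `V₀` the extra `t * t` is the loop term that `col-zero` adds, and monotonicity of the
  -- parabola takes the place of the second difference.
  col-W : ∀ v → col W v + ν (t ℕ.* t) * χ₀ v ≤ ν m * (ν 2 * W v + ν 2)
  col-W v = at (V v) ≡.refl
    where
    open ≤-Reasoning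
    open Col (λ i → ν (parabola i)) parabola-vanishes
    νm : ∀ a b {i} → V v ≡ i → a ℕ.+ b ℕ.≤ 2 ℕ.* parabola i ℕ.+ 2 →
      ν m * (ν a + ν b) ≤ ν m * (ν 2 * W v + ν 2)
    νm a b {i} eq a+b≤ = *-mono-≤ (0≤ν m)
      (≤-respʳ-≈ bound (0≤ν (2 ℕ.* parabola i ℕ.+ 2))) ≤-refl
      (≤-respˡ-≈ (sym (ν-+ a b)) (≤-respʳ-≈ bound (ν-mono-≤ a+b≤)))
      where
      bound : ν (2 ℕ.* parabola i ℕ.+ 2) ≈ ν 2 * W v + ν 2
      bound = trans (ν-+ (2 ℕ.* parabola i) 2) (+-congʳ (trans (ν-* 2 (parabola i))
        (*-congˡ (reflexive (≡.cong (λ i → ν (parabola i)) (≡.sym eq))))))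
    at : ∀ i → V v ≡ i → col W v + ν (t ℕ.* t) * χ₀ v ≤ ν m * (ν 2 * W v + ν 2)
    at zero eq = begin
      col W v + ν (t ℕ.* t) * χ₀ v  ≈⟨ +-congˡ (trans (*-congˡ ([yes] (V v ℕ.≟ 0) eq)) (*-identityʳ _)) ⟩
      col W v + ν (t ℕ.* t)         ≈⟨ col-zero v eq ⟩
      ν m * (ν (parabola 0) + ν (parabola 1))
        ≲⟨ νm (parabola 0) (parabola 1) eq (ℕ.≤-trans (ℕ.+-monoʳ-≤ (parabola 0)
             (ℕ.≤-trans (ℕ.*-mono-≤ (ℕ.m∸n≤m t 1) (ℕ.m∸n≤m t 1)) (ℕ.m≤m+n (parabola 0) 0))) (ℕ.m≤m+n _ 2)) ⟩
      ν m * (ν 2 * W v + ν 2)       ∎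
    at (suc j) eq = begin
      col W v + ν (t ℕ.* t) * χ₀ v
        ≈⟨ +-congˡ (trans (*-congˡ ([no] (V v ℕ.≟ 0) λ e → ℕ.1+n≢0 (≡.trans (≡.sym eq) e))) (zeroʳ _)) ⟩
      col W v + 0#                  ≈⟨ +-identityʳ _ ⟩
      col W v                       ≈⟨ col-suc v eq ⟩
      ν m * (ν (parabola j) + ν (parabola (2 ℕ.+ j)))
        ≲⟨ νm (parabola j) (parabola (2 ℕ.+ j)) eq (parabola-convex j (≡.subst (ℕ._≤ t) eq (V≤t v))) ⟩
      ν m * (ν 2 * W v + ν 2)       ∎

  a₀ : Carrier
  a₀ = ⟨ χ₀ ⟩

  total : Carrier
  total = sum x

  0≤total : 0# ≤ total
  0≤total = sum-nonNeg 0≤x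

  ρW+t²a₀≤ : ρ * ⟨ W ⟩ + ν (t ℕ.* t) * a₀ ≤ ν m * (ν 2 * ⟨ W ⟩ + ν 2 * total)
  ρW+t²a₀≤ = begin
    ρ * ⟨ W ⟩ + ν (t ℕ.* t) * a₀
      ≈⟨ +-cong (⟨col⟩ W) (⟨⟩-scale (ν (t ℕ.* t)) χ₀) ⟨
    ⟨ col W ⟩ + ⟨ (λ u → ν (t ℕ.* t) * χ₀ u) ⟩
      ≈⟨ ⟨⟩-+ (col W) _ ⟨
    ⟨ (λ u → col W u + ν (t ℕ.* t) * χ₀ u) ⟩
      ≲⟨ ⟨⟩-mono col-W ⟩
    ⟨ (λ u → ν m * (ν 2 * W u + ν 2)) ⟩
      ≈⟨ ⟨⟩-scale (ν m) _ ⟩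
    ν m * ⟨ (λ u → ν 2 * W u + ν 2) ⟩
      ≈⟨ *-congˡ (trans (⟨⟩-+ _ _) (+-cong (⟨⟩-scale (ν 2) W) (sym (*-distribˡ-sum {n} (ν 2) x)))) ⟩
    ν m * (ν 2 * ⟨ W ⟩ + ν 2 * total) ∎
    where open ≤-Reasoning

  W≤T²total : ⟨ W ⟩ ≤ sq T * total
  W≤T²total = ≤-respʳ-≈ (sym (*-distribˡ-sum {n} (sq T) x))
    (⟨⟩-mono {W} λ u → ≤-respʳ-≈ (ν-* (suc t) (suc t)) (ν-mono-≤ (ℕ.*-mono-≤ (t∸i≤1+t (V u)) (t∸i≤1+t (V u)))))
    where
    t∸i≤1+t : ∀ i → t ∸ i ℕ.≤ suc t
    t∸i≤1+t i = ℕ.≤-trans (ℕ.m∸n≤m t i) (ℕ.n≤1+n t)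

  -- The constant is 2 + 18: 2 from the second difference, 18 from the loss `18m/T²` in the bound on
  -- `ρ`, whose denominator is absorbed by `W≤T²total`. Everything is multiplied by `T²`, which is
  -- cancelled at the end.
  t²a₀≤20m·total : ν (t ℕ.* t) * a₀ ≤ ν 20 * ν m * total
  t²a₀≤20m·total = 0≤y-x⇒x≤y (*-cancelˡ-nonNeg (suc t ℕ.* suc t) (sym (ν-* (suc t) (suc t)))
    (≤-respʳ-≈
      (solve 7 (λ T² ρ w t² a m s →
        T² :* (m :* (# 2 :* w :+ # 2 :* s) :- (ρ :* w :+ t² :* a)) :+
          (w :* (T² :* ρ :- m :* (# 2 :* T² :- # 18)) :+ # 18 :* (m :* (T² :* s :- w)))
        := T² :* (# 20 :* m :* s :- t² :* a))
        refl (sq T) ρ ⟨ W ⟩ (ν (t ℕ.* t)) a₀ (ν m) total)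
      (+-nonNeg (*-nonNeg (square-nonNeg T) (x≤y⇒0≤y-x ρW+t²a₀≤))
        (+-nonNeg (*-nonNeg 0≤W (x≤y⇒0≤y-x [2T²-18]m≤T²ρ))
          (*-nonNeg (0≤ν 18) (*-nonNeg (0≤ν m) (x≤y⇒0≤y-x W≤T²total)))))))
    where
    0≤W : 0# ≤ ⟨ W ⟩
    0≤W = ⟨⟩-nonNeg (λ u → 0≤ν (parabola (V u)))

  -- Cauchy-Schwarz as nonnegativity of a variance; the deviations from the mean are scaled by `n`
  -- to avoid a quotient.
  total²≤n : sq total ≤ ν n
  total²≤n = 0≤y-x⇒x≤y (*-cancelˡ-nonNeg n refl (≤-respʳ-≈ variance
    (sum-nonNeg (λ u → square-nonNeg (ν n * x u - total)))))
    where
    open import Relation.Binary.Reasoning.Setoid setoid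
    variance : sum (λ u → sq (ν n * x u - total)) ≈ ν n * (ν n - sq total)
    variance = begin
      sum (λ u → sq (ν n * x u - total))
        ≈⟨ sum-cong-≋ (λ u → solve 3 (λ n x s → (n :* x :- s) :* (n :* x :- s) :=
             n :* n :* (x :* x) :+ (:- (# 2 :* n :* s) :* x :+ s :* s)) refl (ν n) (x u) total) ⟩
      sum (λ u → ν n * ν n * (x u * x u) + (- (ν 2 * ν n * total) * x u + sq total))
        ≈⟨ trans (∑-distrib-+ {n} _ _) (+-congˡ (∑-distrib-+ {n} _ _)) ⟩
      sum (λ u → ν n * ν n * (x u * x u)) + (sum (λ u → - (ν 2 * ν n * total) * x u) + sum {n} (λ _ → sq total))
        ≈⟨ +-cong (trans (sym (*-distribˡ-sum {n} (ν n * ν n) _)) (*-congˡ (trans unit (sym ν-1))))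
             (+-cong (sym (*-distribˡ-sum {n} (- (ν 2 * ν n * total)) x)) (sum-const n (sq total))) ⟩
      ν n * ν n * ν 1 + (- (ν 2 * ν n * total) * total + ν n * sq total)
        ≈⟨ solve 2 (λ n s → n :* n :* # 1 :+ (:- (# 2 :* n :* s) :* s :+ n :* (s :* s)) :=
             n :* (n :- s :* s)) refl (ν n) total ⟩
      ν n * (ν n - sq total) ∎

-- The independent set of odd blocks.

does-∈?-tabulate : ∀ {n} (f : Fin n → Bool) u → does (u ∈? tabulate f) ≡ f u
does-∈?-tabulate f zero with f zero
... | true  = ≡.refl
... | false = ≡.refl
does-∈?-tabulate f (suc u) = does-∈?-tabulate (λ v → f (suc v)) u

odd : ℕ → Bool
odd zero    = false
odd (suc i) = not (odd i)

odd-suc : ∀ i j → j ≡ suc i → odd i ≡ true → odd j ≢ true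
odd-suc i j ≡.refl odd-i odd-j = contradiction (≡.trans (≡.sym (≡.cong not odd-i)) odd-j) λ ()

module OddBlocks (n k : ℕ) (2≤k : 2 ℕ.≤ k) where
  private
    V : Fin n → ℕ
    V = block k 2≤k

  S : Subset n
  S = tabulate (λ u → odd (V u))

  ∈S⇒odd : ∀ u → u ∈ S → odd (V u) ≡ true
  ∈S⇒odd u u∈S = ≡.trans (≡.sym (does-∈?-tabulate (λ u → odd (V u)) u)) (dec-true (u ∈? S) u∈S)

  S-independent : Independent (G n k 2≤k) S
  S-independent u v u∈S v∈S = λ where
    (inj₁ (inj₁ e)) → odd-suc (V u) (V v) e (∈S⇒odd u u∈S) (∈S⇒odd v v∈S)
    (inj₁ (inj₂ e)) → odd-suc (V v) (V u) e (∈S⇒odd v v∈S) (∈S⇒odd u u∈S)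
    (inj₂ (e , _))  → contradiction (≡.trans (≡.sym (≡.cong odd e)) (∈S⇒odd u u∈S)) λ ()

-- The alternating weight of the blocks and the final estimate.

module OddBlockWeight (R : OrderedℚAlgebra) (n k : ℕ) (2≤k : 2 ℕ.≤ k)
  (2m≤n : 2 ℕ.* (k ∸ 1) ℕ.≤ n) (P : Blocks.PositiveEigenvector R n k 2≤k) where
  open OrderedℚAlgebra R hiding (zero)
  open Ordered R
  open Blocks R n k 2≤k
  open PositiveEigenvector P
  open Perron R n k 2≤k 2m≤n P
  open OddBlocks n k 2≤k
  open Solver using (solve; _:+_; _:*_; _:-_; :-_; _:=_; _:^_; con)
  open import Algebra.Properties.Semiring.Exp semiring using (_^_; ^-congˡ)

  sgn : ℕ → Carrier
  sgn zero    = 1#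
  sgn (suc i) = - sgn i

  signed : Fin n → Carrier
  signed u = sgn (V u) * x u

  -- As a pairing of the sign-changed eigenvector with `x`, it becomes a quadratic form in `A`
  -- through `⟨col⟩` once multiplied by `ρ`.
  w : Carrier
  w = ⟨ signed ⟩

  A-sym : ∀ u v → A u v ≈ A v u
  A-sym u v = split (Graph.adj? Γ u v)
    where
    split : Dec (Graph.Adj Γ u v) → A u v ≈ A v u
    split (yes uv) = trans ([yes] (Graph.adj? Γ u v) uv)
      (sym ([yes] (Graph.adj? Γ v u) (Graph.symm Γ uv)))
    split (no ¬uv) = trans ([no] (Graph.adj? Γ u v) ¬uv)
      (sym ([no] (Graph.adj? Γ v u) (λ vu → ¬uv (Graph.symm Γ vu))))

  2ρw : Fin n → Fin n → Carrier
  2ρw v u = (sgn (V u) + sgn (V v)) * A u v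

  -- The double sum for `ρ * w` is added to its transpose. By symmetry of `A` each adjacent pair
  -- then carries the sum of its two signs, which is what cancels across consecutive blocks.
  sum-2ρw : ν 2 * (ρ * w) ≈ sum (λ v → sum (λ u → 2ρw v u * (x u * x v)))
  sum-2ρw = begin
    ν 2 * (ρ * w)
      ≈⟨ *-congˡ (sym (⟨col⟩ signed)) ⟩
    ν 2 * ⟨ col signed ⟩
      ≈⟨ *-congˡ (sum-cong-≋ (λ v → *-distribʳ-sum {n} (x v) _)) ⟩
    ν 2 * sum (λ v → sum (λ u → q v u))
      ≈⟨ solve 1 (λ s → # 2 :* s := s :+ s) refl _ ⟩
    sum (λ v → sum (λ u → q v u)) + sum (λ v → sum (λ u → q v u))
      ≈⟨ +-congˡ (∑-comm q) ⟩
    sum (λ v → sum (λ u → q v u)) + sum (λ v → sum (λ u → q u v))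
      ≈⟨ trans (sum-cong-≋ {n} (λ v → ∑-distrib-+ {n} (q v) (λ u → q u v))) (∑-distrib-+ {n} _ _) ⟨
    sum (λ v → sum (λ u → q v u + q u v))
      ≈⟨ sum-cong-≋ (λ v → sum-cong-≋ (λ u → trans (+-congˡ (*-congʳ (*-congˡ (A-sym v u))))
           (solve 5 (λ s s′ a x y → s :* x :* a :* y :+ s′ :* y :* a :* x := (s :+ s′) :* a :* (x :* y))
             refl (sgn (V u)) (sgn (V v)) (A u v) (x u) (x v)))) ⟩
    sum (λ v → sum (λ u → 2ρw v u * (x u * x v))) ∎
    where
    open import Relation.Binary.Reasoning.Setoid setoid
    q : Fin n → Fin n → Carrier
    q v u = signed u * A u v * x v

  -- Edges between consecutive blocks cancel, so only the edges inside V₀ contribute.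
  2ρw-cases : ∀ v u → 2ρw v u ≈ 0# ⊎ (χ₀ u ≈ 1# × χ₀ v ≈ 1# × 2ρw v u ≈ ν 2)
  2ρw-cases v u = split (Graph.adj? Γ u v)
    where
    opposite : ∀ {i j} → j ≡ suc i → sgn i + sgn j ≈ 0#
    opposite {i} ≡.refl = -‿inverseʳ (sgn i)
    split : Dec (Graph.Adj Γ u v) → 2ρw v u ≈ 0# ⊎ (χ₀ u ≈ 1# × χ₀ v ≈ 1# × 2ρw v u ≈ ν 2)
    split (no ¬uv) = inj₁ (trans (*-congˡ ([no] (Graph.adj? Γ u v) ¬uv)) (zeroʳ _))
    split (yes (inj₁ (inj₁ e))) = inj₁ (trans (*-congʳ (opposite e)) (zeroˡ _))
    split (yes (inj₁ (inj₂ e))) = inj₁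
      (trans (*-congʳ (trans (+-comm _ _) (opposite e))) (zeroˡ _))
    split (yes uv@(inj₂ (p , q , _))) = inj₂
      ( [yes] (V u ℕ.≟ 0) p , [yes] (V v ℕ.≟ 0) q
      , trans (*-cong (+-cong (reflexive (≡.cong sgn p)) (reflexive (≡.cong sgn q)))
                ([yes] (Graph.adj? Γ u v) uv))
          (trans (*-identityʳ _) (sym (trans (ν-suc 1) (+-congˡ ν-1)))) )

  0≤2ρw : ∀ v u → 0# ≤ 2ρw v u
  0≤2ρw v u with 2ρw-cases v u
  ... | inj₁ eq           = ≤-reflexive (sym eq)
  ... | inj₂ (_ , _ , eq) = ≤-respʳ-≈ (sym eq) (0≤ν 2)

  2ρw≤2χχ : ∀ v u → 2ρw v u ≤ ν 2 * (χ₀ u * χ₀ v)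
  2ρw≤2χχ v u with 2ρw-cases v u
  ... | inj₁ eq = ≤-respˡ-≈ eq (*-nonNeg (0≤ν 2) (*-nonNeg (0≤[] (V u ℕ.≟ 0)) (0≤[] (V v ℕ.≟ 0))))
  ... | inj₂ (p , q , eq) = ≤-reflexive
    (trans eq (sym (trans (*-congˡ (trans (*-cong p q) (*-identityˡ 1#))) (*-identityʳ (ν 2)))))

  0≤ρw : 0# ≤ ρ * w
  0≤ρw = *-cancelˡ-nonNeg 2 refl (≤-respʳ-≈ (sym sum-2ρw)
    (sum-nonNeg (λ v → sum-nonNeg (λ u → *-nonNeg (0≤2ρw v u) (*-nonNeg (0≤x u) (0≤x v))))))

  ρw≤a₀² : ρ * w ≤ a₀ * a₀
  ρw≤a₀² = 0≤y-x⇒x≤y (*-cancelˡ-nonNeg 2 refl (≤-respʳ-≈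
    (solve 2 (λ a w → # 2 :* a :- # 2 :* w := # 2 :* (a :- w)) refl (a₀ * a₀) (ρ * w))
    (x≤y⇒0≤y-x 2ρw≤2a₀²)))
    where
    open ≤-Reasoning
    2ρw≤2a₀² : ν 2 * (ρ * w) ≤ ν 2 * (a₀ * a₀)
    2ρw≤2a₀² = begin
      ν 2 * (ρ * w)
        ≈⟨ sum-2ρw ⟩
      sum (λ v → sum (λ u → 2ρw v u * (x u * x v)))
        ≲⟨ sum-mono-≤ (λ v → sum-mono-≤ (λ u → *-monoʳ-≤ (*-nonNeg (0≤x u) (0≤x v)) (2ρw≤2χχ v u))) ⟩
      sum (λ v → sum (λ u → ν 2 * (χ₀ u * χ₀ v) * (x u * x v)))
        ≈⟨ sum-cong-≋ (λ v → trans
             (sum-cong-≋ (λ u → solve 5 (λ c a b x y → c :* (a :* b) :* (x :* y) := c :* (b :* y) :* (a :* x))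
               refl (ν 2) (χ₀ u) (χ₀ v) (x u) (x v)))
             (trans (sym (*-distribˡ-sum {n} (ν 2 * (χ₀ v * x v)) _))
               (solve 3 (λ c y a → c :* y :* a := c :* a :* y) refl (ν 2) (χ₀ v * x v) a₀))) ⟩
      sum (λ v → ν 2 * a₀ * (χ₀ v * x v))
        ≈⟨ trans (sym (*-distribˡ-sum {n} (ν 2 * a₀) _)) (*-assoc (ν 2) a₀ a₀) ⟩
      ν 2 * (a₀ * a₀) ∎

  0≤w : 0# ≤ w
  0≤w = *-cancel-nonNeg (ℚ.positive⁻¹ (+ m / 1) {{ℚ.normalize-pos m 1}}) m≤ρ 0≤ρw

  ν-^ : ∀ a e → ν (a ℕ.^ e) ≈ ν a ^ e
  ν-^ a zero    = ν-1
  ν-^ a (suc e) = trans (ν-* a (a ℕ.^ e)) (*-congˡ (ν-^ a e))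

  -- From `n ≤ (t + 1)m ≤ 2tm`. The fourth power supplies the `t⁴` needed to square the bound on
  -- `t²a₀`; one factor `n` comes back from `total²≤n`.
  n⁴≤16t⁴m⁴ : ν n ^ 4 ≤ ν 16 * (sq (ν (t ℕ.* t)) * ν m ^ 4)
  n⁴≤16t⁴m⁴ = ≤-respˡ-≈ (sym (ν-^ n 4)) (≤-respʳ-≈ eq (ν-mono-≤ (ℕ.^-monoˡ-≤ 4 n≤2tm)))
    where
    n≤2tm : n ℕ.≤ 2 ℕ.* t ℕ.* m
    n≤2tm = ℕ.≤-trans n≤[1+t]m (ℕ.*-monoˡ-≤ m
      (ℕ.+-mono-≤ (ℕ.≤-trans (s≤s z≤n) 2≤t) (ℕ.≤-reflexive (≡.sym (ℕ.+-identityʳ t)))))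
    eq : ν ((2 ℕ.* t ℕ.* m) ℕ.^ 4) ≈ ν 16 * (sq (ν (t ℕ.* t)) * ν m ^ 4)
    eq = begin
      ν ((2 ℕ.* t ℕ.* m) ℕ.^ 4)       ≈⟨ ν-^ (2 ℕ.* t ℕ.* m) 4 ⟩
      ν (2 ℕ.* t ℕ.* m) ^ 4           ≈⟨ ^-congˡ 4 (trans (ν-* (2 ℕ.* t) m) (*-congʳ (ν-* 2 t))) ⟩
      (ν 2 * ν t * ν m) ^ 4
        ≈⟨ solve 2 (λ t m → (# 2 :* t :* m) :^ 4 := # 16 :* ((t :* t) :* (t :* t) :* m :^ 4)) refl (ν t) (ν m) ⟩
      ν 16 * (sq (ν t * ν t) * ν m ^ 4)  ≈⟨ *-congˡ (*-congʳ (sq-cong (ν-* t t))) ⟨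
      ν 16 * (sq (ν (t ℕ.* t)) * ν m ^ 4)  ∎
      where open import Relation.Binary.Reasoning.Setoid setoid

  -- One of the four factors `m` is spent on `m * w ≤ ρ * w ≤ a₀ * a₀`. The other three remain
  -- beside `(t²a₀)²`, whose bound contributes `m²`, and `6400 = 16 * 20²`.
  n³w≤6400m⁵ : ν n ^ 3 * w ≤ ν 6400 * ν m ^ 5
  n³w≤6400m⁵ = 0≤y-x⇒x≤y (*-cancelˡ-nonNeg n refl (≤-respʳ-≈
    (solve 3 (λ n w m → n :* (# 6400 :* m :^ 5) :- n :^ 4 :* w :=
      n :* (# 6400 :* m :^ 5 :- n :^ 3 :* w)) refl (ν n) w (ν m)) (x≤y⇒0≤y-x n⁴w≤)))
    where
    open ≤-Reasoning
    0≤m^ : ∀ e → 0# ≤ ν m ^ e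
    0≤m^ e = ≤-respʳ-≈ (ν-^ m e) (0≤ν (m ℕ.^ e))
    t² : Carrier
    t² = ν (t ℕ.* t)
    0≤a₀ : 0# ≤ a₀
    0≤a₀ = ⟨⟩-nonNeg (λ u → 0≤[] (V u ℕ.≟ 0))
    n⁴w≤ : ν n ^ 4 * w ≤ ν n * (ν 6400 * ν m ^ 5)
    n⁴w≤ = begin
      ν n ^ 4 * w
        ≲⟨ *-monoʳ-≤ 0≤w n⁴≤16t⁴m⁴ ⟩
      ν 16 * (sq t² * ν m ^ 4) * w
        ≈⟨ solve 3 (λ t m w → # 16 :* (t :* t :* m :^ 4) :* w := m :* w :* (# 16 :* (t :* t :* m :^ 3)))
             refl t² (ν m) w ⟩
      ν m * w * (ν 16 * (sq t² * ν m ^ 3))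
        ≲⟨ *-monoʳ-≤ (*-nonNeg (0≤ν 16) (*-nonNeg (square-nonNeg t²) (0≤m^ 3)))
             (≤-trans (*-monoʳ-≤ 0≤w m≤ρ) ρw≤a₀²) ⟩
      a₀ * a₀ * (ν 16 * (sq t² * ν m ^ 3))
        ≈⟨ solve 3 (λ a t m → a :* a :* (# 16 :* (t :* t :* m :^ 3)) :=
             (t :* a) :* (t :* a) :* (# 16 :* m :^ 3)) refl a₀ t² (ν m) ⟩
      sq (t² * a₀) * (ν 16 * ν m ^ 3)
        ≲⟨ *-monoʳ-≤ (*-nonNeg (0≤ν 16) (0≤m^ 3))
             (*-mono-≤ (*-nonNeg (0≤ν (t ℕ.* t)) 0≤a₀) (*-nonNeg (*-nonNeg (0≤ν 20) (0≤ν m)) 0≤total)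
               t²a₀≤20m·total t²a₀≤20m·total) ⟩
      sq (ν 20 * ν m * total) * (ν 16 * ν m ^ 3)
        ≈⟨ solve 2 (λ m s → (# 20 :* m :* s) :* (# 20 :* m :* s) :* (# 16 :* m :^ 3) :=
             s :* s :* (# 6400 :* m :^ 5)) refl (ν m) total ⟩
      sq total * (ν 6400 * ν m ^ 5)
        ≲⟨ *-monoʳ-≤ (*-nonNeg (0≤ν 6400) (0≤m^ 5)) total²≤n ⟩
      ν n * (ν 6400 * ν m ^ 5) ∎

  oddWeight : Carrier
  oddWeight = sum (λ u → if does (u ∈? S) then x u * x u else 0#)

  -- Unit length reads `1 = w + 2 * oddWeight`.
  ½-oddWeight : ι ½ - oddWeight ≈ ι ½ * w
  ½-oddWeight = begin
    ι ½ - oddWeight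
      ≈⟨ +-congʳ (trans (sym (*-identityʳ (ι ½))) (*-congˡ (trans (sym unit) split))) ⟩
    ι ½ * (w + ν 2 * oddWeight) - oddWeight
      ≈⟨ solve 2 (λ w o → con ½ :* (w :+ # 2 :* o) :- o := con ½ :* w) refl w oddWeight ⟩
    ι ½ * w ∎
    where
    open import Relation.Binary.Reasoning.Setoid setoid
    -- The sign is -1 exactly at odd indices, where the doubled term restores `y`.
    sgn-odd : ∀ i y → y ≈ sgn i * y + ν 2 * (if odd i then y else 0#)
    sgn-odd zero    y = sym (trans (+-cong (*-identityˡ y) (zeroʳ (ν 2))) (+-identityʳ y))
    sgn-odd (suc i) y with odd i | sgn-odd i y
    ... | true  | eq = begin
      y                              ≈⟨ solve 1 (λ y → y := :- y :+ # 2 :* y) refl y ⟩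
      - y + ν 2 * y                  ≈⟨ +-congʳ (-‿cong eq) ⟩
      - (sgn i * y + ν 2 * y) + ν 2 * y
        ≈⟨ solve 2 (λ s y → :- (s :* y :+ # 2 :* y) :+ # 2 :* y := :- s :* y) refl (sgn i) y ⟩
      - sgn i * y                    ≈⟨ trans (+-congˡ (zeroʳ (ν 2))) (+-identityʳ _) ⟨
      - sgn i * y + ν 2 * 0#         ∎
    ... | false | eq = begin
      y                              ≈⟨ solve 1 (λ y → y := :- y :+ # 2 :* y) refl y ⟩
      - y + ν 2 * y
        ≈⟨ +-congʳ (-‿cong (trans eq (trans (+-congˡ (zeroʳ (ν 2))) (+-identityʳ _)))) ⟩
      - (sgn i * y) + ν 2 * y        ≈⟨ solve 2 (λ s y → :- (s :* y) :+ # 2 :* y := :- s :* y :+ # 2 :* y) refl (sgn i) y ⟩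
      - sgn i * y + ν 2 * y          ∎
    split : sum (λ u → x u * x u) ≈ w + ν 2 * oddWeight
    split = begin
      sum (λ u → x u * x u)
        ≈⟨ sum-cong-≋ (λ u → trans (sgn-odd (V u) (x u * x u)) (+-cong (sym (*-assoc (sgn (V u)) (x u) (x u)))
             (reflexive (≡.cong (λ b → ν 2 * (if b then x u * x u else 0#))
               (≡.sym (does-∈?-tabulate (λ u → odd (V u)) u)))))) ⟩
      sum (λ u → signed u * x u + ν 2 * (if does (u ∈? S) then x u * x u else 0#))
        ≈⟨ trans (∑-distrib-+ {n} _ _) (+-congˡ (sym (*-distribˡ-sum {n} (ν 2) _))) ⟩
      w + ν 2 * oddWeight ∎

  oddWeight≤½ : oddWeight ≤ ι ½
  oddWeight≤½ = 0≤y-x⇒x≤y (≤-respʳ-≈ (sym ½-oddWeight) (*-nonNeg (0≤ι (from-yes (0ℚ ℚ.≤? ½))) 0≤w))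

  -- Half of 6400, with `m ≤ k`. The rational quotient enters only through its product with `n³`.
  ½-oddWeight≤ : .{{_ : NonZero (n ℕ.^ 3)}} →
    ι ½ - oddWeight ≤ ι (+ 3200 / 1) * ι (+ (k ℕ.^ 5) / (n ℕ.^ 3))
  ½-oddWeight≤ = 0≤y-x⇒x≤y (*-cancelˡ-nonNeg (n ℕ.^ 3) (sym (ν-^ n 3)) (≤-respʳ-≈ eq
    (*-nonNeg (0≤ι (from-yes (0ℚ ℚ.≤? ½))) (x≤y⇒0≤y-x n³w≤6400k⁵))))
    where
    open import Relation.Binary.Reasoning.Setoid setoid
    r : Carrier
    r = ι (+ (k ℕ.^ 5) / (n ℕ.^ 3))
    n³w≤6400k⁵ : ν n ^ 3 * w ≤ ν 6400 * ν (k ℕ.^ 5)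
    n³w≤6400k⁵ = ≤-trans n³w≤6400m⁵ (*-mono-≤ (0≤ν 6400) (0≤ν (k ℕ.^ 5)) ≤-refl
      (≤-respˡ-≈ (sym (ν-^ m 5)) (ν-mono-≤ (ℕ.^-monoˡ-≤ 5 (ℕ.m∸n≤m k 1)))))
    rn³≈k⁵ : r * ν n ^ 3 ≈ ν (k ℕ.^ 5)
    rn³≈k⁵ = trans (*-congˡ (sym (ν-^ n 3))) (trans (sym (ι-homo-* _ _))
      (reflexive (≡.cong ι ([a/b]*b≡a (k ℕ.^ 5) (n ℕ.^ 3)))))
    eq : ι ½ * (ν 6400 * ν (k ℕ.^ 5) - ν n ^ 3 * w) ≈ ν n ^ 3 * (ν 3200 * r - (ι ½ - oddWeight))
    eq = begin
      ι ½ * (ν 6400 * ν (k ℕ.^ 5) - ν n ^ 3 * w)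
        ≈⟨ *-congˡ (+-congʳ (*-congˡ (sym rn³≈k⁵))) ⟩
      ι ½ * (ν 6400 * (r * ν n ^ 3) - ν n ^ 3 * w)
        ≈⟨ solve 3 (λ r n w → con ½ :* (# 6400 :* (r :* n) :- n :* w) :=
             n :* (# 3200 :* r :- con ½ :* w)) refl r (ν n ^ 3) w ⟩
      ν n ^ 3 * (ν 3200 * r - ι ½ * w)
        ≈⟨ *-congˡ (+-congˡ (-‿cong (sym ½-oddWeight))) ⟩
      ν n ^ 3 * (ν 3200 * r - (ι ½ - oddWeight)) ∎

  oddWeight-½-bounds : .{{_ : NonZero (n ℕ.^ 3)}} →
    let bound = ι (+ 3200 / 1) * ι (+ (k ℕ.^ 5) / (n ℕ.^ 3)) in
    oddWeight - ι ½ ≤ bound × - (oddWeight - ι ½) ≤ bound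
  oddWeight-½-bounds =
    -- Since `oddWeight ≤ ½`, the difference is at most its own negative, so one estimate gives both
    -- bounds.
    ≤-trans (0≤y-x⇒x≤y (≤-respʳ-≈
        (solve 2 (λ h o → (h :- o) :+ (h :- o) := (h :- o) :- (o :- h)) refl (ι ½) oddWeight)
        (+-nonNeg (x≤y⇒0≤y-x oddWeight≤½) (x≤y⇒0≤y-x oddWeight≤½)))) ½-oddWeight≤
    , ≤-respˡ-≈ (solve 2 (λ h o → :- (o :- h) := h :- o) refl (ι ½) oddWeight) ½-oddWeight≤

-- Specialisation to the reals and to Perron vectors.

open Reals

ℝ-orderedℚAlgebra : OrderedℚAlgebra
ℝ-orderedℚAlgebra = record
  { commutativeRing = ℝ-commutativeRing
  ; _≤_ = _≤ᴿ_
  ; ≤-reflexive = λ {x} {y} → ≤ᴿ-reflexive x y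
  ; ≤-trans = λ {x} {y} {z} → ≤ᴿ-trans x y z
  ; +-mono-≤ = λ {x} {y} {u} {v} → +ᴿ-mono-≤ᴿ x y u v
  ; *-nonNeg = λ {x} {y} → 0≤x*ᴿy x y
  ; square-nonNeg = λ x → eventually-≤⇒≤ᴿ 0ᴿ (x *ᴿ x) (0 , λ n _ → p*p≥0 (seq x n))
  ; ι = fromℚ
  ; ι-mono-≤ = λ {p} {q} p≤q → eventually-≤⇒≤ᴿ (fromℚ p) (fromℚ q) (0 , λ _ _ → p≤q)
  ; ι-homo-+ = λ p q → pointwise (fromℚ (p ℚ.+ q)) (fromℚ p +ᴿ fromℚ q) λ _ → ≡.refl
  ; ι-homo-* = λ p q → pointwise (fromℚ (p ℚ.* q)) (fromℚ p *ᴿ fromℚ q) λ _ → ≡.refl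
  ; ι-homo-neg = λ p → pointwise (fromℚ (ℚ.- p)) (-ᴿ fromℚ p) λ _ → ≡.refl
  ; ι-homo-0 = pointwise 0ᴿ 0ᴿ λ _ → ≡.refl
  ; ι-homo-1 = pointwise 1ᴿ 1ᴿ λ _ → ≡.refl
  ; *-cancel-nonNeg = λ {q} {x} {y} → 0≤y-from-x*ᴿy q x y
  }

0<ᴿ⇒fromℚ≤ᴿ : ∀ x → 0ᴿ <ᴿ x → ∃[ q ] 0ℚ ℚ.< q × fromℚ q ≤ᴿ x
0<ᴿ⇒fromℚ≤ᴿ x (q , 0<q , N , h) = q , 0<q , eventually-≤⇒≤ᴿ (fromℚ q) x
  (N , λ n N≤n → ≡.subst (ℚ._≤ seq x n) (ℚ.+-identityˡ q) (h n N≤n))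

perron⇒positiveEigenvector : ∀ n k 2≤k {x} → IsPerronVector (G n k 2≤k) x →
  Blocks.PositiveEigenvector ℝ-orderedℚAlgebra n k 2≤k
perron⇒positiveEigenvector n k 2≤k {x} perron = record
  { x     = x
  ; ρ     = ρ
  ; eigen = proj₂ eigenvector
  ; x-pos = λ u → 0<ᴿ⇒fromℚ≤ᴿ (x u) (pos u)
  ; unit  = unit
  }
  where open IsPerronVector perron

open import Data.Nat.Base using (_≤_; _*_; _^_)
open import Data.Nat.Properties using (m^n≢0)

theorem5p1 : ∃[ C ] (∀ (n k : ℕ) .{{_ : NonZero n}} (2≤k : 2 ≤ k) → 2 * (k ∸ 1) ≤ n →
    ∀ (x : Fin n → ℝ) → IsPerronVector (G n k 2≤k) x →
    ∃[ S ] (Independent (G n k 2≤k) S ×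
    ∣ (∑[ u ∈ S ] (x u *ᴿ x u)) -ᴿ fromℚ ½ ∣ᴿ
    ≤ᴿ C *ᴿ fromℚ (((+ (k ^ 5)) / (n ^ 3)) {{m^n≢0 n 3}})))
theorem5p1 = fromℚ (+ 3200 / 1) , λ n k 2≤k 2m≤n x perron →
  OddBlocks.S n k 2≤k , OddBlocks.S-independent n k 2≤k ,
  uncurry (∣x∣≤ᴿ
      ((∑[ u ∈ OddBlocks.S n k 2≤k ] (x u *ᴿ x u)) -ᴿ fromℚ ½)
      (fromℚ (+ 3200 / 1) *ᴿ fromℚ (((+ (k ^ 5)) / (n ^ 3)) {{m^n≢0 n 3}})))
    (OddBlockWeight.oddWeight-½-bounds ℝ-orderedℚAlgebra n k 2≤k 2m≤n
      (perron⇒positiveEigenvector n k 2≤k perron) {{m^n≢0 n 3}})
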